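{- Let $\mathcal{F}$ be a finite frieze of positive integers. Then its growth sequence $(s_0,s_1,s_2,\dots)$ is one of the following (each continued periodically): $$(2,-2,2,-2,2,-2,\dots),\qquad (2,0,-2,0,2,0,-2,\dots),\qquad (2,1,-1,-2,-1,1,2,1,\dots).$$ (The periods are $2$, $4$ and $6$ respectively.) The first of these growth sequences arises precisely when the associated triangulation has no rotational symmetry. The second and third respectively arise from triangulations with $180$ degree and $120$ degree rotational symmetry.
   Context: A finite frieze of positive integers of order $n\ge3$ is an array $(m_{i,j})$ indexed by $i\in\mathbb{Z}$, $-2\le j-i\le n-2$, with $m_{i,i-2}=m_{i,i+n-2}=0$, $m_{i,i-1}=m_{i,i+n-3}=1$, with all entries with $-1\le j-i\le n-3$ positive integers, and with $m_{i,j}m_{i+1,j+1}-m_{i,j+1}m_{i+1,j}=1$ whenever all four entries lie in the array. Such a frieze is $n$-periodic ($m_{i+n,j+n}=m_{i,j}$). By Conway and Coxeter it corresponds to a triangulation of a convex $n$-gon: $a_i=m_{i,i}$, $i=1,\dots,n$, is the number of triangles incident with vertex $i$ of the triangulation (vertices taken in anti-clockwise order); this is the associated triangulation. Rotational symmetry refers to non-trivial rotations of the regular $n$-gon preserving the triangulation. The lattice of the frieze is the unique extension $(m_{i,j})_{i,j\in\mathbb{Z}}$ of the array satisfying $m_{i,j}=-m_{j+2,i-2}$ and $m_{i,j}=-m_{j-n+2,i+n-2}$ for all $i,j\in\mathbb{Z}$ (anti-symmetric mirroring across the rows of zeros). The growth sequence is $(s_k)_{k\ge0}$ with $s_0:=2$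 and $s_k:=m_{1,kp}-m_{2,kp-1}$ for $k\ge1$, where $p$ is the minimal period of the frieze, i.e. the least $p\ge1$ with $m_{i+p,j+p}=m_{i,j}$ for all entries. -}

module Defs where

open import Level using (0ℓ)
open import Data.Nat.Base as ℕ using (ℕ; zero; suc; NonZero)
open import Data.Nat.DivMod using (_mod_)
open import Data.Integer.Base
  using (ℤ; +_; -_; _+_; _-_; _*_; _≤_; _<_)
open import Data.Fin.Base using (Fin; toℕ) renaming (_<_ to _<ᶠ_)
import Data.Fin.Properties as Fin
open import Data.List.Base using (length; filter; cartesianProduct; allFin)
open import Data.Product.Base using (_×_; _,_; ∃)
open import Data.Sum.Base using (_⊎_)
open import Data.Vec.Base using (Vec; _∷_; []; lookup)
open import Function.Bundles using (_⇔_)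
open import Relation.Binary.Core using (Rel)
open import Relation.Binary.Definitions using (Symmetric; Decidable)
open import Relation.Binary.PropositionalEquality using (_≡_; _≢_)
open import Relation.Nullary using (¬_; Dec)
open import Relation.Nullary.Decidable using (_×-dec_; _⊎-dec_)

IsLeast : (ℕ → Set) → ℕ → Set
IsLeast P p = P p × (∀ q → P q → p ℕ.≤ q)

InArray : ℕ → ℤ → ℤ → Set
InArray n i j = (- + 2 ≤ j - i) × (j - i ≤ + n - + 2)

-- The index condition is an irrelevant argument of each entry, so an entry
-- depends only on its position.
record Frieze (n : ℕ) : Set where
  field
    m        : (i j : ℤ) → .(InArray n i j) → ℤ
    zeros₀   : ∀ i .(h : InArray n i (i - + 2)) → m i (i - + 2) h ≡ + 0
    zeros₁   : ∀ i .(h : InArray n i (i + + n - + 2)) →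
               m i (i + + n - + 2) h ≡ + 0
    ones₀    : ∀ i .(h : InArray n i (i - + 1)) → m i (i - + 1) h ≡ + 1
    ones₁    : ∀ i .(h : InArray n i (i + + n - + 3)) →
               m i (i + + n - + 3) h ≡ + 1
    entries⁺ : ∀ i j .(h : InArray n i j) →
               - + 1 ≤ j - i → j - i ≤ + n - + 3 → + 0 < m i j h
    diamond  : ∀ i j
               .(h₀₀ : InArray n i j)
               .(h₁₁ : InArray n (i + + 1) (j + + 1))
               .(h₀₁ : InArray n i (j + + 1))
               .(h₁₀ : InArray n (i + + 1) j) →
               m i j h₀₀ * m (i + + 1) (j + + 1) h₁₁
                 - m i (j + + 1) h₀₁ * m (i + + 1) j h₁₀ ≡ + 1

module _ {n : ℕ} (F : Frieze n) where
  open Frieze F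

  IsPeriod : ℕ → Set
  IsPeriod p = (1 ℕ.≤ p) ×
    (∀ i j .(h : InArray n i j) .(h′ : InArray n (i + + p) (j + + p)) →
      m (i + + p) (j + + p) h′ ≡ m i j h)

  IsMinimalPeriod : ℕ → Set
  IsMinimalPeriod = IsLeast IsPeriod

  -- The reflections (i , j) ↦ (j + 2 , i - 2) and
  -- (i , j) ↦ (j - n + 2 , i + n - 2) fix precisely the two rows of zeros, and
  -- the array is a fundamental domain for the group they generate; hence this
  -- structure exists and ℓ is determined by F.
  record Lattice : Set where
    field
      ℓ       : ℤ → ℤ → ℤ
      extends : ∀ i j .(h : InArray n i j) → ℓ i j ≡ m i j h
      mirror₀ : ∀ i j → ℓ i j ≡ - ℓ (j + + 2) (i - + 2)
      mirror₁ : ∀ i j → ℓ i j ≡ - ℓ (j - + n + + 2) (i + + n - + 2)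

growth : ∀ {n} {F : Frieze n} → Lattice F → (p : ℕ) → ℕ → ℤ
growth L p zero      = + 2
growth L p k@(suc _) = ℓ (+ 1) (+ (k ℕ.* p)) - ℓ (+ 2) (+ (k ℕ.* p) - + 1)
  where open Lattice L

cyclic : ∀ {q} → Vec ℤ (suc q) → ℕ → ℤ
cyclic {q} xs k = lookup xs (k mod suc q)

sequence₁ sequence₂ sequence₃ : ℕ → ℤ
sequence₁ = cyclic (+ 2 ∷ - + 2 ∷ [])
sequence₂ = cyclic (+ 2 ∷ + 0 ∷ - + 2 ∷ + 0 ∷ [])
sequence₃ = cyclic (+ 2 ∷ + 1 ∷ - + 1 ∷ - + 2 ∷ - + 1 ∷ + 1 ∷ [])

IsLeastPeriodOf : (ℕ → ℤ) → ℕ → Set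
IsLeastPeriodOf s = IsLeast λ q → (1 ℕ.≤ q) × (∀ k → s (k ℕ.+ q) ≡ s k)

-- The vertices of the regular n-gon are the elements of Fin n, in
-- anticlockwise order; `rotate t` is the rotation through t/n of a full turn.
rotate : ∀ {n} .{{_ : NonZero n}} → ℕ → Fin n → Fin n
rotate {n} t v = (toℕ v ℕ.+ t) mod n

module _ {n : ℕ} .{{_ : NonZero n}} where

  Adjacent : Rel (Fin n) 0ℓ
  Adjacent u v = (v ≡ rotate 1 u) ⊎ (u ≡ rotate 1 v)

  IsDiagonal : Rel (Fin n) 0ℓ
  IsDiagonal u v = u ≢ v × ¬ Adjacent u v

  Anticlockwise : Fin n → Fin n → Fin n → Set
  Anticlockwise u v w =
    (u <ᶠ v × v <ᶠ w) ⊎ (v <ᶠ w × w <ᶠ u) ⊎ (w <ᶠ u × u <ᶠ v)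

  -- The chords ab and cd meet in their interiors: c and d lie strictly on
  -- opposite sides of ab.
  Crossing : Fin n → Fin n → Fin n → Fin n → Set
  Crossing a b c d =
    (Anticlockwise a c b × Anticlockwise b d a) ⊎
    (Anticlockwise a d b × Anticlockwise b c a)

-- A maximal set of pairwise non-crossing diagonals.
record Triangulation (n : ℕ) .{{_ : NonZero n}} : Set₁ where
  field
    Diag        : Rel (Fin n) 0ℓ
    diag?       : Decidable Diag
    symmetric   : Symmetric Diag
    isDiagonal  : ∀ {a b} → Diag a b → IsDiagonal a b
    nonCrossing : ∀ {a b c d} → Diag a b → Diag c d → ¬ Crossing a b c d
    maximal     : ∀ {a b} → IsDiagonal a b →
                  (∀ {c d} → Diag c d → ¬ Crossing a b c d) → Diag a b

module _ {n : ℕ} .{{_ : NonZero n}} (T : Triangulation n) where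
  open Triangulation T

  Edge : Rel (Fin n) 0ℓ
  Edge u v = Adjacent u v ⊎ Diag u v

  edge? : Decidable Edge
  edge? u v = ((v Fin.≟ rotate 1 u) ⊎-dec (u Fin.≟ rotate 1 v)) ⊎-dec diag? u v

  -- All vertices lie on the boundary, so any three pairwise joined vertices
  -- span a triangle of T. The triangles at v are listed by their two other
  -- vertices, in increasing order.
  IsTriangleAt : Fin n → Fin n × Fin n → Set
  IsTriangleAt v (u , w) = u <ᶠ w × Edge v u × Edge v w × Edge u w

  isTriangleAt? : ∀ v uw → Dec (IsTriangleAt v uw)
  isTriangleAt? v (u , w) =
    (u Fin.<? w) ×-dec edge? v u ×-dec edge? v w ×-dec edge? u w

  trianglesAt : Fin n → ℕ
  trianglesAt v =
    length (filter (isTriangleAt? v) (cartesianProduct (allFin n) (allFin n)))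

  -- The vertex labelled i ∈ {1, …, n} is the element of Fin n with value i - 1.
  IsAssociatedTo : Frieze n → Set
  IsAssociatedTo F =
    ∀ (v : Fin n) → let i = + suc (toℕ v) in
    .(h : InArray n i i) → m i i h ≡ + trianglesAt v
    where open Frieze F

  Preserves : ℕ → Set
  Preserves t = ∀ u v → Diag u v ⇔ Diag (rotate t u) (rotate t v)

  HasRotationalSymmetry : Set
  HasRotationalSymmetry = ∃ λ t → 0 ℕ.< t × t ℕ.< n × Preserves t

  -- `rotate t` is the rotation through 180° when 2t = n, and through 120° when
  -- 3t = n.
  Has180°Symmetry : Set
  Has180°Symmetry = ∃ λ t → 2 ℕ.* t ≡ n × Preserves t

  Has120°Symmetry : Set
  Has120°Symmetry = ∃ λ t → 3 ℕ.* t ≡ n × Preserves t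

{-# OPTIONS --safe #-}

-- Let a i = m i i. The solutions of z (i + 1) + z (i - 1) = a i * z i form a
-- free module of rank 2, and m i j = det (i - 1) (j + 1), where det u v is the
-- determinant of the values at u and v of a basis of solutions. The zero and one
-- rows make every solution n-antiperiodic, so p divides n, say n = r p. The
-- translation by p acts on solutions by a matrix M of determinant 1, s_k = tr Mᵏ,
-- and M = - 1 if r = 1. With t = tr M, Cayley–Hamilton shows that the entries
-- c_k = det 0 (k p) satisfy c_{k+2} = t c_{k+1} - c_k; they are positive for
-- 0 < k < r and c_r = 0, so r ≥ 2 forces (r , t) = (2 , 0) or (3 , 1).
--
-- The periods of the frieze are the rotations preserving the triangulation T:
-- counting triangles shows that z u + z w = z v for each triangle u < v < w,
-- whence det u v = 1 for every diagonal of T. By Ptolemy's relation crossing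
-- diagonals cannot both have determinant ± 1, so by maximality T consists
-- precisely of the diagonals with determinant ± 1.

module Submission where

import Algebra.Properties.AbelianGroup as AbelianGroup
open import Data.Fin.Base as Fin using (Fin; toℕ; fromℕ<)
  renaming (_<_ to _<ᶠ_; _≤_ to _≤ᶠ_; _>_ to _>ᶠ_)
import Data.Fin.Induction as Fin
import Data.Fin.Properties as Fin
open import Data.Integer.Base as ℤ using (ℤ; +_; -[1+_]; -_; _+_; _-_; _*_)
import Data.Integer.DivMod as ℤ
import Data.Integer.Properties as ℤ
open import Data.Integer.Tactic.RingSolver using (solve-∀)
open import Data.List.Base using (List; []; _∷_; length; filter; map; cartesianProduct; allFin)
open import Data.List.Membership.Propositional using (_∈_)
open import Data.List.Membership.Propositional.Properties
  using (∈-filter⁺; ∈-filter⁻; ∈-map⁺; ∈-map⁻; ∈-allFin; ∈-cartesianProduct⁺)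
open import Data.List.Membership.Propositional.Properties.WithK using (unique∧set⇒bag)
open import Data.List.Properties using (filter-none; length-map)
open import Data.List.Relation.Binary.BagAndSetEquality using (∼bag⇒↭)
open import Data.List.Relation.Binary.Permutation.Propositional.Properties using (↭-length)
open import Data.List.Relation.Unary.All as All using ()
open import Data.List.Relation.Unary.AllPairs using ([]; _∷_)
open import Data.List.Relation.Unary.Any using (here)
open import Data.List.Relation.Unary.Unique.Propositional using (Unique)
import Data.List.Relation.Unary.Unique.Propositional.Properties as Unique
open import Data.Nat.Base as ℕ using (ℕ; zero; suc; NonZero; _≤_; z≤n; s≤s)
open import Data.Nat.Divisibility
  using (_∣_; _∣?_; divides; m%n≡0⇒n∣m; ∣⇒≤; *-cancelʳ-∣; *-monoʳ-∣)
open import Data.Nat.DivMod as ℕ using (_%_; _/_; _mod_)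
import Data.Nat.Properties as ℕ
open import Data.Product.Base as Product using (_×_; _,_; ∃; proj₁; proj₂; map₁; map₂; swap)
open import Data.Product.Properties using (≡-dec)
open import Data.Sum.Base as Sum using (_⊎_; inj₁; inj₂; [_,_]′)
open import Data.Vec.Base using (Vec; []; _∷_; lookup)
open import Defs
open import Function.Base using (_∘_; id; case_of_)
open import Function.Bundles using (_⇔_; mk⇔; Equivalence)
open import Induction.WellFounded using (Acc; acc)
open import Level using (Level)
open import Relation.Binary.Definitions using (tri<; tri≈; tri>)
open import Relation.Binary.PropositionalEquality
  using (_≡_; _≢_; _≗_; refl; sym; trans; cong; cong₂; subst; subst₂; ≢-sym; module ≡-Reasoning)
open import Relation.Nullary using (¬_; yes; no; contradiction)
open import Relation.Nullary.Decidable using (_×-dec_; from-no)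
open import Relation.Unary using (Pred; Decidable)

-- Two-sided linear recurrences

-- Behind the bound on `r` stands an eigenvalue argument. Translation by `n` acts as `- 1`, so
-- `Mʳ = - 1`, and positivity of `c_k` for `0 < k < r` singles out the eigenvalues exp(± πi / r).
-- Hence `t = 2 cos (π / r)`, which is an integer only for `r = 1 , 2 , 3`, with the values
-- `- 2 , 0 , 1`. The formal argument replaces the complex numbers by inequalities between the first
-- few `c_k`. Two objects are given by data that do not mention the recurrence. The lattice is known
-- only through its reflections; on the width `j - i + 2` they act as `e ↦ - e` and `e ↦ 2 n - e`,
-- and determinants obey the same two rules. The triangulation is known only through the number of
-- triangles at each vertex, which is not local to any one triangle. The relation `z u + z w = z v`
-- is therefore proved together with statements about the smaller polygons cut off by edges, in
-- which only the triangles at the two end vertices are counted.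

ℤ-induction : ∀ {ℓ} (P : ℤ → Set ℓ) → P (+ 0) →
              (∀ i → P i → P (ℤ.suc i)) → (∀ i → P (ℤ.suc i) → P i) → ∀ i → P i
ℤ-induction P base up down (+ zero)      = base
ℤ-induction P base up down (+ suc n)     = up (+ n) (ℤ-induction P base up down (+ n))
ℤ-induction P base up down -[1+ zero ]   = down -[1+ 0 ] base
ℤ-induction P base up down -[1+ suc n ]  =
  down -[1+ suc n ] (ℤ-induction P base up down -[1+ n ])

suc-+ : ∀ i j → ℤ.suc i + j ≡ ℤ.suc (i + j)
suc-+ = ℤ.+-assoc (+ 1)

module Recurrence (a : ℤ → ℤ) where

  record IsSolution (z : ℤ → ℤ) : Set where
    field
      step : ∀ i → z (ℤ.suc (ℤ.suc i)) + z i ≡ a (ℤ.suc i) * z (ℤ.suc i)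

    next : ∀ i → z (ℤ.suc (ℤ.suc i)) ≡ a (ℤ.suc i) * z (ℤ.suc i) - z i
    next i = trans (identity (z (ℤ.suc (ℤ.suc i))) (z i)) (cong (_- z i) (step i))
      where
      identity : ∀ p q → p ≡ p + q - q
      identity = solve-∀

    previous : ∀ i → z i ≡ a (ℤ.suc i) * z (ℤ.suc i) - z (ℤ.suc (ℤ.suc i))
    previous i = trans (identity (z (ℤ.suc (ℤ.suc i))) (z i)) (cong (_- z (ℤ.suc (ℤ.suc i))) (step i))
      where
      identity : ∀ p q → q ≡ p + q - p
      identity = solve-∀

  open IsSolution

  private
    forward backward : ℤ → ℤ × ℤ → ℤ × ℤ
    forward  i (p , q) = q , a (ℤ.suc i) * q - p
    backward i (p , q) = a (ℤ.suc i) * p - q , p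

    -- The state at `i` is the pair of consecutive values at `i` and `i + 1`, starting from `s` at
    -- `0`.
    state : ℤ × ℤ → ℤ → ℤ × ℤ
    state s (+ zero)     = s
    state s (+ suc n)    = forward (+ n) (state s (+ n))
    state s -[1+ zero ]  = backward -[1+ 0 ] s
    state s -[1+ suc n ] = backward -[1+ suc n ] (state s -[1+ n ])

    cancel : ∀ b p q → b * p - (b * p - q) ≡ q
    cancel = solve-∀

    -- At negative indices this says that `forward` undoes `backward`; the first components agree by
    -- computation.
    state-suc : ∀ s i → state s (ℤ.suc i) ≡ forward i (state s i)
    state-suc s (+ n)        = refl
    state-suc s -[1+ zero ]  = cong (proj₁ s ,_) (sym (cancel (a (+ 0)) (proj₁ s) (proj₂ s)))
    state-suc s -[1+ suc n ] = cong (proj₁ t ,_) (sym (cancel (a -[1+ n ]) (proj₁ t) (proj₂ t)))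
      where t = state s -[1+ n ]

  solution : ℤ → ℤ → ℤ → ℤ
  solution z₀ z₁ i = proj₁ (state (z₀ , z₁) i)

  solution-isSolution : ∀ z₀ z₁ → IsSolution (solution z₀ z₁)
  solution-isSolution z₀ z₁ .step i = begin
    solution z₀ z₁ (ℤ.suc (ℤ.suc i)) + p
      ≡⟨ cong (λ t → proj₁ t + p) (state-suc _ (ℤ.suc i)) ⟩
    proj₂ (state _ (ℤ.suc i)) + p
      ≡⟨ cong (λ t → proj₂ t + p) (state-suc _ i) ⟩
    a (ℤ.suc i) * q - p + p
      ≡⟨ identity (a (ℤ.suc i) * q) p ⟩
    a (ℤ.suc i) * q
      ≡⟨ cong (λ t → a (ℤ.suc i) * proj₁ t) (state-suc _ i) ⟨
    a (ℤ.suc i) * solution z₀ z₁ (ℤ.suc i) ∎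
    where
    open ≡-Reasoning
    p = proj₁ (state (z₀ , z₁) i)
    q = proj₂ (state (z₀ , z₁) i)
    identity : ∀ r p → r - p + p ≡ r
    identity = solve-∀

  x y : ℤ → ℤ
  x = solution (+ 1) (+ 0)
  y = solution (+ 0) (+ 1)

  x-isSolution : IsSolution x
  x-isSolution = solution-isSolution (+ 1) (+ 0)

  y-isSolution : IsSolution y
  y-isSolution = solution-isSolution (+ 0) (+ 1)

  solution-unique : ∀ {z w} → IsSolution z → IsSolution w →
                    z (+ 0) ≡ w (+ 0) → z (+ 1) ≡ w (+ 1) → ∀ i → z i ≡ w i
  solution-unique {z} {w} hz hw e₀ e₁ i = proj₁ (ℤ-induction P (e₀ , e₁) up down i)
    where
    P : ℤ → Set
    P i = z i ≡ w i × z (ℤ.suc i) ≡ w (ℤ.suc i)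
    up : ∀ i → P i → P (ℤ.suc i)
    up i (e , e′) = e′ , trans (next hz i)
      (trans (cong₂ (λ p q → a (ℤ.suc i) * p - q) e′ e) (sym (next hw i)))
    down : ∀ i → P (ℤ.suc i) → P i
    down i (e , e′) = trans (previous hz i)
      (trans (cong₂ (λ p q → a (ℤ.suc i) * p - q) e e′) (sym (previous hw i))) , e

  combination-isSolution : ∀ {z w} p q → IsSolution z → IsSolution w →
                           IsSolution (λ i → z i * p + w i * q)
  combination-isSolution {z} {w} p q hz hw .step i = trans
    (identity₁ (z (ℤ.suc (ℤ.suc i))) (z i) (w (ℤ.suc (ℤ.suc i))) (w i) p q)
    (trans (cong₂ (λ s t → s * p + t * q) (step hz i) (step hw i))
      (identity₂ (a (ℤ.suc i)) (z (ℤ.suc i)) (w (ℤ.suc i)) p q))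
    where
    identity₁ : ∀ z₂ z₀ w₂ w₀ p q →
                (z₂ * p + w₂ * q) + (z₀ * p + w₀ * q) ≡ (z₂ + z₀) * p + (w₂ + w₀) * q
    identity₁ = solve-∀
    identity₂ : ∀ b z w p q → (b * z) * p + (b * w) * q ≡ b * (z * p + w * q)
    identity₂ = solve-∀

  basis : ∀ {z} → IsSolution z → ∀ i → z i ≡ x i * z (+ 0) + y i * z (+ 1)
  basis {z} hz = solution-unique hz
    (combination-isSolution (z (+ 0)) (z (+ 1)) x-isSolution y-isSolution)
    (identity₀ (z (+ 0)) (z (+ 1))) (identity₁ (z (+ 0)) (z (+ 1)))
    where
    identity₀ : ∀ p q → p ≡ + 1 * p + + 0 * q
    identity₀ = solve-∀
    identity₁ : ∀ p q → q ≡ + 0 * p + + 1 * q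
    identity₁ = solve-∀

  opaque
    -- Opaque, so that goals about entries do not unfold into polynomials in the values of `x` and
    -- `y`.
    det : ℤ → ℤ → ℤ
    det u v = x u * y v - y u * x v

  opaque
    unfolding det

    det-basis : ∀ u v → det u v ≡ x u * y v - y u * x v
    det-basis u v = refl

    det-antisym : ∀ u v → det u v ≡ - det v u
    det-antisym u v = identity (x u) (y u) (x v) (y v)
      where
      identity : ∀ p q r s → p * s - q * r ≡ - (r * q - s * p)
      identity = solve-∀

    det-isSolution : ∀ u → IsSolution (det u)
    det-isSolution u .step i = trans
      (identity₁ (x u) (y u) (x (ℤ.suc (ℤ.suc i))) (x i) (y (ℤ.suc (ℤ.suc i))) (y i))
      (trans (cong₂ (λ s t → x u * s - y u * t) (step y-isSolution i) (step x-isSolution i))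
        (identity₂ (x u) (y u) (a (ℤ.suc i)) (x (ℤ.suc i)) (y (ℤ.suc i))))
      where
      identity₁ : ∀ p q x₂ x₀ y₂ y₀ →
                  (p * y₂ - q * x₂) + (p * y₀ - q * x₀) ≡ p * (y₂ + y₀) - q * (x₂ + x₀)
      identity₁ = solve-∀
      identity₂ : ∀ p q b x y → p * (b * y) - q * (b * x) ≡ b * (p * y - q * x)
      identity₂ = solve-∀

    det-self : ∀ u → det u u ≡ + 0
    det-self u = identity (x u) (y u)
      where
      identity : ∀ p q → p * q - q * p ≡ + 0
      identity = solve-∀

    -- The discrete Wronskian of `x` and `y`: one step of the recurrence has determinant 1, so it is
    -- constant, and its value at `0` is read off from the initial values.
    det-suc : ∀ u → det u (ℤ.suc u) ≡ + 1
    det-suc = ℤ-induction _ refl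
      (λ i e → trans (sym (shift i)) e) (λ i e → trans (shift i) e)
      where
      identity : ∀ x₀ y₀ x₁ y₁ b x₂ y₂ → x₂ + x₀ ≡ b * x₁ → y₂ + y₀ ≡ b * y₁ →
                 x₀ * y₁ - y₀ * x₁ ≡ x₁ * y₂ - y₁ * x₂
      identity x₀ y₀ x₁ y₁ b x₂ y₂ ex ey = trans (ring x₀ y₀ x₁ y₁ x₂ y₂)
        (trans (cong₂ (λ s t → s * y₁ - t * x₁ + (x₁ * y₂ - y₁ * x₂)) ex ey)
               (ring′ x₁ y₁ b x₂ y₂))
        where
        ring : ∀ x₀ y₀ x₁ y₁ x₂ y₂ → x₀ * y₁ - y₀ * x₁ ≡
               (x₂ + x₀) * y₁ - (y₂ + y₀) * x₁ + (x₁ * y₂ - y₁ * x₂)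
        ring = solve-∀
        ring′ : ∀ x₁ y₁ b x₂ y₂ →
                (b * x₁) * y₁ - (b * y₁) * x₁ + (x₁ * y₂ - y₁ * x₂) ≡ x₁ * y₂ - y₁ * x₂
        ring′ = solve-∀
      shift : ∀ i → det i (ℤ.suc i) ≡ det (ℤ.suc i) (ℤ.suc (ℤ.suc i))
      shift i = identity (x i) (y i) (x (ℤ.suc i)) (y (ℤ.suc i)) (a (ℤ.suc i)) _ _
                  (step x-isSolution i) (step y-isSolution i)

    -- The relation between the minors of four vectors in the plane. For a quadrilateral
    -- `s < t < u < v` the left-hand side is the product of the diagonals, as in Ptolemy's theorem.
    plücker : ∀ s t u v → det s u * det t v ≡ det s t * det u v + det s v * det t u
    plücker s t u v = identity (x s) (y s) (x t) (y t) (x u) (y u) (x v) (y v)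
      where
      identity : ∀ x₁ y₁ x₂ y₂ x₃ y₃ x₄ y₄ →
        (x₁ * y₃ - y₁ * x₃) * (x₂ * y₄ - y₂ * x₄) ≡
        (x₁ * y₂ - y₁ * x₂) * (x₃ * y₄ - y₃ * x₄) + (x₁ * y₄ - y₁ * x₄) * (x₂ * y₃ - y₂ * x₃)
      identity = solve-∀

    -- Evaluations at three points are three functionals on a module of rank 2, hence dependent;
    -- Cramer's rule gives the coefficients.
    cramer : ∀ {z} → IsSolution z → ∀ s u v → z s * det u v ≡ det s v * z u + det u s * z v
    cramer {z} hz s u v
      rewrite basis hz s | basis hz u | basis hz v =
        identity (x s) (y s) (x u) (y u) (x v) (y v) (z (+ 0)) (z (+ 1))
      where
      identity : ∀ x₁ y₁ x₂ y₂ x₃ y₃ p q →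
        (x₁ * p + y₁ * q) * (x₂ * y₃ - y₂ * x₃) ≡
        (x₁ * y₃ - y₁ * x₃) * (x₂ * p + y₂ * q) + (x₂ * y₁ - y₂ * x₁) * (x₃ * p + y₃ * q)
      identity = solve-∀

  Periodic : ℤ → Set
  Periodic t = ∀ i → a (i + t) ≡ a i

  periodic-multiple : ∀ {t} k → Periodic (+ t) → Periodic (+ (k ℕ.* t))
  periodic-multiple     zero    per i = cong a (ℤ.+-identityʳ i)
  periodic-multiple {t} (suc k) per i =
    trans (cong a (sym (ℤ.+-assoc i (+ t) (+ (k ℕ.* t)))))
      (trans (periodic-multiple k per (i + + t)) (per i))

  periodic-cancel : ∀ {s t} → Periodic (+ t) → Periodic (+ (s ℕ.+ t)) → Periodic (+ s)
  periodic-cancel {s} {t} per-t per-s+t i = trans (sym (per-t (i + + s)))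
    (trans (cong a (ℤ.+-assoc i (+ s) (+ t))) (per-s+t i))

  shift-isSolution : ∀ {t z} → Periodic t → IsSolution z → IsSolution (λ i → z (i + t))
  shift-isSolution {t} {z} per hz .step i
    rewrite suc-+ (ℤ.suc i) t | suc-+ i t =
      trans (step hz (i + t))
        (cong (_* z (ℤ.suc (i + t))) (trans (cong a (sym (suc-+ i t))) (per (ℤ.suc i))))

  shift-basis : ∀ {t z} → Periodic t → IsSolution z →
                ∀ i → z (i + t) ≡ x i * z t + y i * z (ℤ.suc t)
  shift-basis {t} {z} per hz i = trans (basis (shift-isSolution per hz) i)
    (cong (λ j → x i * z j + y i * z (ℤ.suc t)) (ℤ.+-identityˡ t))

  -- For a period `t`, `shift-basis` shows that translation takes `x` and `y` to the solutions with
  -- coordinates `(x t , x (t + 1))` and `(y t , y (t + 1))`; this is the trace of the resulting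
  -- matrix.
  trace : ℤ → ℤ
  trace t = x t + y (ℤ.suc t)

  opaque
    unfolding det

    -- Determinants are multiplied by that of the translation matrix, which is `det t (ℤ.suc t)` and
    -- so equals 1 by `det-suc`.
    det-shift : ∀ {t} → Periodic t → ∀ u v → det (u + t) (v + t) ≡ det u v
    det-shift {t} per u v
      rewrite shift-basis per x-isSolution u | shift-basis per y-isSolution u
            | shift-basis per x-isSolution v | shift-basis per y-isSolution v =
        trans (identity (x u) (y u) (x v) (y v) (x t) (y t) (x (ℤ.suc t)) (y (ℤ.suc t)))
          (trans (cong (det u v *_) (det-suc t)) (ℤ.*-identityʳ _))
      where
      identity : ∀ x₁ y₁ x₂ y₂ p q r s →
        (x₁ * p + y₁ * r) * (x₂ * q + y₂ * s) - (x₁ * q + y₁ * s) * (x₂ * p + y₂ * r) ≡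
        (x₁ * y₂ - y₁ * x₂) * (p * s - q * r)
      identity = solve-∀

    -- The identity `M² = tr M · M - det M` in coordinates, where `det M` is again
    -- `det t (ℤ.suc t)`.
    cayley-hamilton : ∀ {t z} → Periodic t → IsSolution z →
                      ∀ i → z (i + t + t) ≡ trace t * z (i + t) - z i
    cayley-hamilton {t} {z} per hz i = begin
      z (i + t + t)
        ≡⟨ shift-basis per hz (i + t) ⟩
      x (i + t) * z t + y (i + t) * z (ℤ.suc t)
        ≡⟨ cong₂ _+_
             (cong₂ _*_ (shift-basis per x-isSolution i) (basis hz t))
             (cong₂ _*_ (shift-basis per y-isSolution i) (basis hz (ℤ.suc t))) ⟩
      (x i * x t + y i * x (ℤ.suc t)) * (x t * z (+ 0) + y t * z (+ 1))
        + (x i * y t + y i * y (ℤ.suc t)) * (x (ℤ.suc t) * z (+ 0) + y (ℤ.suc t) * z (+ 1))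
        ≡⟨ identity (x i) (y i) (x t) (y t) (x (ℤ.suc t)) (y (ℤ.suc t)) (z (+ 0)) (z (+ 1)) ⟩
      trace t * (x i * (x t * z (+ 0) + y t * z (+ 1))
                  + y i * (x (ℤ.suc t) * z (+ 0) + y (ℤ.suc t) * z (+ 1)))
        - det t (ℤ.suc t) * (x i * z (+ 0) + y i * z (+ 1))
        ≡⟨ cong₂ (λ p q → trace t * p - q)
             (cong₂ (λ p q → x i * p + y i * q) (basis hz t) (basis hz (ℤ.suc t)))
             (cong₂ _*_ (sym (det-suc t)) (basis hz i)) ⟨
      trace t * (x i * z t + y i * z (ℤ.suc t)) - + 1 * z i
        ≡⟨ cong₂ (λ p q → trace t * p - q) (sym (shift-basis per hz i)) (ℤ.*-identityˡ (z i)) ⟩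
      trace t * z (i + t) - z i ∎
      where
      open ≡-Reasoning
      identity : ∀ x₁ y₁ p q r s z₀ z₁ →
        (x₁ * p + y₁ * r) * (p * z₀ + q * z₁) + (x₁ * q + y₁ * s) * (r * z₀ + s * z₁) ≡
        (p + s) * (x₁ * (p * z₀ + q * z₁) + y₁ * (r * z₀ + s * z₁))
          - (p * s - q * r) * (x₁ * z₀ + y₁ * z₁)
      identity = solve-∀

-- The lattice of a frieze

module LatticeTheory {m : ℕ} (2≤m : 2 ≤ m) {F : Frieze (suc m)} (L : Lattice F) where
  open Frieze F renaming (m to entry)
  open Lattice L

  n : ℕ
  n = suc m

  quiddity : ℤ → ℤ
  quiddity i = ℓ i i

  -- The rows of zeros are the rows 0 and n.
  row : ℕ → ℤ → ℤ
  row e i = ℓ i (i + + e - + 2)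

  inArray : ∀ e i j → e ≤ n → j - i ≡ + e - + 2 → InArray n i j
  inArray e i j e≤n eq =
    subst (- + 2 ℤ.≤_) (sym eq) (ℤ.+-monoˡ-≤ (- + 2) {+ 0} {+ e} (ℤ.+≤+ z≤n)) ,
    subst (ℤ._≤ + n - + 2) (sym eq) (ℤ.+-monoˡ-≤ (- + 2) (ℤ.+≤+ e≤n))

  column : ∀ e i → i + e - + 2 - i ≡ e - + 2
  column e i = identity i e
    where
    identity : ∀ i e → i + e - + 2 - i ≡ e - + 2
    identity = solve-∀

  row-zero : ∀ i → row 0 i ≡ + 0
  row-zero i = trans (cong (λ j → ℓ i (j - + 2)) (ℤ.+-identityʳ i))
    (trans (extends i (i - + 2) h) (zeros₀ i h))
    where
    identity : ∀ i → i - + 2 - i ≡ - + 2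
    identity = solve-∀
    h = inArray 0 i (i - + 2) z≤n (identity i)

  row-one : ∀ i → row 1 i ≡ + 1
  row-one i = trans (cong (ℓ i) (identity i)) (trans (extends i (i - + 1) h) (ones₀ i h))
    where
    identity : ∀ i → i + + 1 - + 2 ≡ i - + 1
    identity = solve-∀
    identity′ : ∀ i → i - + 1 - i ≡ - + 1
    identity′ = solve-∀
    h = inArray 1 i (i - + 1) (s≤s z≤n) (identity′ i)

  row-n : ∀ i → row n i ≡ + 0
  row-n i = trans (extends i _ h) (zeros₁ i h)
    where h = inArray n i (i + + n - + 2) ℕ.≤-refl (column (+ n) i)

  row-pred-n : ∀ i → row m i ≡ + 1
  row-pred-n i = trans (cong (ℓ i) (identity i (+ m))) (trans (extends i _ h) (ones₁ i h))
    where
    identity : ∀ i k → i + k - + 2 ≡ i + (+ 1 + k) - + 3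
    identity = solve-∀
    h = inArray m i (i + + n - + 3) (ℕ.n≤1+n m) (subst (λ j → j - i ≡ + m - + 2) (identity i (+ m)) (column (+ m) i))

  row-positive : ∀ e i → 1 ≤ e → e ≤ m → + 0 ℤ.< row e i
  row-positive e i 1≤e e≤m = subst (+ 0 ℤ.<_) (sym (extends i _ h))
    (entries⁺ i _ h
      (subst (- + 1 ℤ.≤_) (sym (column (+ e) i)) (ℤ.+-monoˡ-≤ (- + 2) (ℤ.+≤+ 1≤e)))
      (subst₂ ℤ._≤_ (sym (trans (column (+ e) i) (identity (+ e)))) refl
        (ℤ.+-monoˡ-≤ (- + 3) (ℤ.+≤+ (s≤s e≤m)))))
    where
    identity : ∀ e → e - + 2 ≡ + 1 + e - + 3
    identity = solve-∀
    h = inArray e i (i + + e - + 2) (ℕ.m≤n⇒m≤1+n e≤m) (column (+ e) i)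

  row-diamond : ∀ e i → suc (suc e) ≤ n →
    row (suc e) i * row (suc e) (ℤ.suc i) - row (suc (suc e)) i * row e (ℤ.suc i) ≡ + 1
  row-diamond e i 2+e≤n = begin
    row (suc e) i * row (suc e) (ℤ.suc i) - row (suc (suc e)) i * row e (ℤ.suc i)
      ≡⟨ cong₂ _-_
           (cong₂ _*_ (extends i j h₀₀)
             (trans (cong₂ ℓ (ℤ.+-comm (+ 1) i) (identity₁₁ i (+ e))) (extends _ _ h₁₁)))
           (cong₂ _*_
             (trans (cong (ℓ i) (identity₀₁ i (+ e))) (extends _ _ h₀₁))
             (trans (cong₂ ℓ (ℤ.+-comm (+ 1) i) (identity₁₀ i (+ e))) (extends _ _ h₁₀))) ⟩
    entry i j h₀₀ * entry (i + + 1) (j + + 1) h₁₁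
      - entry i (j + + 1) h₀₁ * entry (i + + 1) j h₁₀
      ≡⟨ diamond i j h₀₀ h₁₁ h₀₁ h₁₀ ⟩
    + 1 ∎
    where
    open ≡-Reasoning
    j = i + + suc e - + 2
    identity₁₁ : ∀ i e → + 1 + i + (+ 1 + e) - + 2 ≡ i + (+ 1 + e) - + 2 + + 1
    identity₁₁ = solve-∀
    identity₀₁ : ∀ i e → i + (+ 2 + e) - + 2 ≡ i + (+ 1 + e) - + 2 + + 1
    identity₀₁ = solve-∀
    identity₁₀ : ∀ i e → + 1 + i + e - + 2 ≡ i + (+ 1 + e) - + 2
    identity₁₀ = solve-∀
    width₁₁ : ∀ i e → i + (+ 1 + e) - + 2 + + 1 - (i + + 1) ≡ + 1 + e - + 2
    width₁₁ = solve-∀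
    width₀₁ : ∀ i e → i + (+ 1 + e) - + 2 + + 1 - i ≡ + 2 + e - + 2
    width₀₁ = solve-∀
    width₁₀ : ∀ i e → i + (+ 1 + e) - + 2 - (i + + 1) ≡ e - + 2
    width₁₀ = solve-∀
    1+e≤n : suc e ≤ n
    1+e≤n = ℕ.≤-trans (ℕ.n≤1+n (suc e)) 2+e≤n
    h₀₀ = inArray (suc e) i j 1+e≤n (column (+ suc e) i)
    h₁₁ = inArray (suc e) (i + + 1) (j + + 1) 1+e≤n (width₁₁ i (+ e))
    h₀₁ = inArray (suc (suc e)) i (j + + 1) 2+e≤n (width₀₁ i (+ e))
    h₁₀ = inArray e (i + + 1) j (ℕ.≤-trans (ℕ.n≤1+n e) 1+e≤n) (width₁₀ i (+ e))

  -- Adjacent diamonds show that (row (2+e) + row e) / row (1+e) is constant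
  -- along diagonals; its value is read off at e = 0.
  row-recurrence : ∀ e i → suc (suc e) ≤ n →
    row (suc (suc e)) i + row e i ≡ quiddity (i + + e) * row (suc e) i
  row-recurrence zero i _
    rewrite row-zero i | row-one i = trans (ℤ.+-identityʳ (row 2 i))
      (trans (cong₂ ℓ (sym (ℤ.+-identityʳ i)) (identity i)) (sym (ℤ.*-identityʳ _)))
    where
    identity : ∀ i → i + + 2 - + 2 ≡ i + + 0
    identity = solve-∀
  row-recurrence (suc e) i 3+e≤n = ℤ.*-cancelˡ-≡ r₁₁ _ _ {{r₁₁≢0}} (begin
    r₁₁ * (r₃₀ + r₁₀)
      ≡⟨ identity₁ r₁₁ r₃₀ r₁₀ ⟩
    r₃₀ * r₁₁ + r₁₀ * r₁₁
      ≡⟨ cong₂ _+_ (rearrange (r₂₀ * r₂₁) (r₃₀ * r₁₁) (row-diamond (suc e) i 3+e≤n))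
                    (rearrange′ (r₁₀ * r₁₁) (r₂₀ * r₀₁) (row-diamond e i 2+e≤n)) ⟩
    (r₂₀ * r₂₁ - + 1) + (r₂₀ * r₀₁ + + 1)
      ≡⟨ identity₂ r₂₀ r₂₁ r₀₁ ⟩
    r₂₀ * (r₂₁ + r₀₁)
      ≡⟨ cong (r₂₀ *_) (row-recurrence e (ℤ.suc i) 2+e≤n) ⟩
    r₂₀ * (quiddity (ℤ.suc i + + e) * r₁₁)
      ≡⟨ cong (λ j → r₂₀ * (quiddity j * r₁₁)) (identity₄ i (+ e)) ⟩
    r₂₀ * (quiddity (i + + suc e) * r₁₁)
      ≡⟨ identity₃ r₂₀ (quiddity (i + + suc e)) r₁₁ ⟩
    r₁₁ * (quiddity (i + + suc e) * r₂₀) ∎)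
    where
    open ≡-Reasoning
    r₁₀ = row (suc e) i
    r₂₀ = row (suc (suc e)) i
    r₃₀ = row (suc (suc (suc e))) i
    r₀₁ = row e (ℤ.suc i)
    r₁₁ = row (suc e) (ℤ.suc i)
    r₂₁ = row (suc (suc e)) (ℤ.suc i)
    2+e≤n = ℕ.≤-trans (ℕ.n≤1+n (suc (suc e))) 3+e≤n
    -- The bound `3+e≤n` places this row strictly between the two rows of zeros, where entries are
    -- positive.
    r₁₁≢0 : ℤ.NonZero r₁₁
    r₁₁≢0 = ℤ.≢-nonZero λ r₁₁≡0 → ℤ.<-irrefl (sym r₁₁≡0)
      (row-positive (suc e) (ℤ.suc i) (s≤s z≤n) (ℕ.≤-trans (ℕ.n≤1+n (suc e)) (ℕ.≤-pred 3+e≤n)))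
    rearrange : ∀ p q {r} → p - q ≡ r → q ≡ p - r
    rearrange p q refl = identity p q
      where
      identity : ∀ p q → q ≡ p - (p - q)
      identity = solve-∀
    rearrange′ : ∀ p q {r} → p - q ≡ r → p ≡ q + r
    rearrange′ p q refl = identity p q
      where
      identity : ∀ p q → p ≡ q + (p - q)
      identity = solve-∀
    identity₁ : ∀ p q r → p * (q + r) ≡ q * p + r * p
    identity₁ = solve-∀
    identity₂ : ∀ p q r → (p * q - + 1) + (p * r + + 1) ≡ p * (q + r)
    identity₂ = solve-∀
    identity₃ : ∀ p q r → p * (q * r) ≡ r * (q * p)
    identity₃ = solve-∀
    identity₄ : ∀ i e → + 1 + i + e ≡ i + (+ 1 + e)
    identity₄ = solve-∀

  open Recurrence quiddity public
  open IsSolution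

  -- As functions of `e` both sides begin with 0 and 1 and obey the same second-order recurrence.
  -- Hence `go` carries two consecutive rows, the second under a bound because the array ends at row
  -- `n`.
  row≡det : ∀ e u → e ≤ n → row e (ℤ.suc u) ≡ det u (+ e + u)
  row≡det e u e≤n = proj₁ (go e e≤n)
    where
    shift : ∀ e → ℤ.suc (+ e + u) ≡ + suc e + u
    shift e = sym (ℤ.+-assoc (+ 1) (+ e) u)
    identity : ∀ u e → + 1 + u + e ≡ + 1 + (e + u)
    identity = solve-∀
    go : ∀ e → e ≤ n → row e (ℤ.suc u) ≡ det u (+ e + u) ×
         (suc e ≤ n → row (suc e) (ℤ.suc u) ≡ det u (+ suc e + u))
    go zero    _ = trans (row-zero _) (sym (trans (cong (det u) (ℤ.+-identityˡ u)) (det-self u))) ,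
                   λ _ → trans (row-one _) (sym (det-suc u))
    go (suc e) 1+e≤n with ih₀ , ih₁ ← go e (ℕ.≤-trans (ℕ.n≤1+n e) 1+e≤n) = ih₁ 1+e≤n , λ 2+e≤n →
      AbelianGroup.∙-cancelʳ ℤ.+-0-abelianGroup (row e (ℤ.suc u)) _ _ (begin
        row (suc (suc e)) (ℤ.suc u) + row e (ℤ.suc u)
          ≡⟨ row-recurrence e (ℤ.suc u) 2+e≤n ⟩
        quiddity (ℤ.suc u + + e) * row (suc e) (ℤ.suc u)
          ≡⟨ cong₂ _*_ (cong quiddity (identity u (+ e)))
               (trans (ih₁ 1+e≤n) (cong (det u) (sym (shift e)))) ⟩
        quiddity (ℤ.suc (+ e + u)) * det u (ℤ.suc (+ e + u))
          ≡⟨ step (det-isSolution u) (+ e + u) ⟨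
        det u (ℤ.suc (ℤ.suc (+ e + u))) + det u (+ e + u)
          ≡⟨ cong₂ _+_ (cong (det u) (trans (cong ℤ.suc (shift e)) (shift (suc e)))) (sym ih₀) ⟩
        det u (+ suc (suc e) + u) + row e (ℤ.suc u) ∎)
      where open ≡-Reasoning

  -- By the second row of zeros `det u (n + u)` vanishes, so evaluation at `n + u` is a multiple of
  -- evaluation at `u`. The adjacent row of ones fixes the factor: `cramer` against `v = m + u`
  -- gives `- 1`.
  solution-antiperiodic : ∀ {z} → IsSolution z → ∀ u → z (+ n + u) ≡ - z u
  solution-antiperiodic {z} hz u = begin
    z w                              ≡⟨ ℤ.*-identityʳ (z w) ⟨
    z w * + 1                        ≡⟨ cong (z w *_) det-u-v ⟨
    z w * det u v                    ≡⟨ cramer hz w u v ⟩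
    det w v * z u + det u w * z v    ≡⟨ cong₂ (λ s t → s * z u + t * z v) det-w-v det-u-w ⟩
    - + 1 * z u + + 0 * z v          ≡⟨ identity (z u) (z v) ⟩
    - z u                            ∎
    where
    open ≡-Reasoning
    v = + m + u
    w = + n + u
    det-u-v : det u v ≡ + 1
    det-u-v = trans (sym (row≡det m u (ℕ.n≤1+n m))) (row-pred-n (ℤ.suc u))
    det-u-w : det u w ≡ + 0
    det-u-w = trans (sym (row≡det n u ℕ.≤-refl)) (row-n (ℤ.suc u))
    det-w-v : det w v ≡ - + 1
    det-w-v = trans (det-antisym w v)
      (cong -_ (trans (cong (det v) (ℤ.+-assoc (+ 1) (+ m) u)) (det-suc v)))
    identity : ∀ p q → - + 1 * p + + 0 * q ≡ - p
    identity = solve-∀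

  det-antiperiodicʳ : ∀ u v → det u (+ n + v) ≡ - det u v
  det-antiperiodicʳ u = solution-antiperiodic (det-isSolution u)

  det-antiperiodicˡ : ∀ u v → det (+ n + u) v ≡ - det u v
  det-antiperiodicˡ u v = trans (det-antisym (+ n + u) v)
    (trans (cong -_ (det-antiperiodicʳ v u)) (cong -_ (sym (det-antisym u v))))

  private
    -- The lattice is compared with the determinants one width at a time, because each reflection
    -- permutes the widths: `mirror₀` matches the antisymmetry of `det`, and `mirror₁` matches its
    -- antisymmetry together with one sign from antiperiodicity in each argument.
    Agree : ℤ → Set
    Agree e = ∀ i → ℓ i (i + e - + 2) ≡ det (i - + 1) (i + e - + 1)

    agree-mirror₀ : ∀ e → Agree e → Agree (- e)
    agree-mirror₀ e h i = begin
      ℓ i j                                ≡⟨ mirror₀ i j ⟩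
      - ℓ (j + + 2) (i - + 2)              ≡⟨ cong (λ k → - ℓ (j + + 2) k) (identity₁ i e) ⟩
      - ℓ (j + + 2) (j + + 2 + e - + 2)    ≡⟨ cong -_ (h (j + + 2)) ⟩
      - det (j + + 2 - + 1) (j + + 2 + e - + 1)
        ≡⟨ cong -_ (cong₂ det (identity₂ i e) (identity₃ i e)) ⟩
      - det (i + (- e) - + 1) (i - + 1)    ≡⟨ det-antisym (i - + 1) (i + (- e) - + 1) ⟨
      det (i - + 1) (i + (- e) - + 1)      ∎
      where
      open ≡-Reasoning
      j = i + (- e) - + 2
      identity₁ : ∀ i e → i - + 2 ≡ i + (- e) - + 2 + + 2 + e - + 2
      identity₁ = solve-∀
      identity₂ : ∀ i e → i + (- e) - + 2 + + 2 - + 1 ≡ i + (- e) - + 1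
      identity₂ = solve-∀
      identity₃ : ∀ i e → i + (- e) - + 2 + + 2 + e - + 1 ≡ i - + 1
      identity₃ = solve-∀

    agree-mirror₁ : ∀ e → Agree e → Agree (+ n + + n - e)
    agree-mirror₁ e h i = begin
      ℓ i j                                       ≡⟨ mirror₁ i j ⟩
      - ℓ k (i + + n - + 2)                       ≡⟨ cong (λ l → - ℓ k l) (identity₁ i e (+ n)) ⟩
      - ℓ k (k + e - + 2)                         ≡⟨ cong -_ (h k) ⟩
      - det (k - + 1) (k + e - + 1)               ≡⟨ cong (λ l → - det (k - + 1) l) (identity₂ i e (+ n)) ⟩
      - det (k - + 1) (+ n + (i - + 1))           ≡⟨ cong -_ (det-antiperiodicʳ (k - + 1) (i - + 1)) ⟩
      - - det (k - + 1) (i - + 1)                 ≡⟨ cong -_ (det-antiperiodicˡ (k - + 1) (i - + 1)) ⟨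
      - det (+ n + (k - + 1)) (i - + 1)           ≡⟨ det-antisym (i - + 1) (+ n + (k - + 1)) ⟨
      det (i - + 1) (+ n + (k - + 1))             ≡⟨ cong (det (i - + 1)) (identity₃ i e (+ n)) ⟩
      det (i - + 1) (i + (+ n + + n - e) - + 1)   ∎
      where
      open ≡-Reasoning
      j = i + (+ n + + n - e) - + 2
      k = j - + n + + 2
      identity₁ : ∀ i e n → i + n - + 2 ≡ i + (n + n - e) - + 2 - n + + 2 + e - + 2
      identity₁ = solve-∀
      identity₂ : ∀ i e n → i + (n + n - e) - + 2 - n + + 2 + e - + 1 ≡ n + (i - + 1)
      identity₂ = solve-∀
      identity₃ : ∀ i e n → n + (i + (n + n - e) - + 2 - n + + 2 - + 1) ≡ i + (n + n - e) - + 1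
      identity₃ = solve-∀

    agree-array : ∀ e → e ≤ n → Agree (+ e)
    agree-array e e≤n i = begin
      row e i                         ≡⟨ cong (row e) (identity₁ i) ⟩
      row e (ℤ.suc (i - + 1))         ≡⟨ row≡det e (i - + 1) e≤n ⟩
      det (i - + 1) (+ e + (i - + 1)) ≡⟨ cong (det (i - + 1)) (identity₂ i (+ e)) ⟩
      det (i - + 1) (i + + e - + 1)   ∎
      where
      open ≡-Reasoning
      identity₁ : ∀ i → i ≡ + 1 + (i - + 1)
      identity₁ = solve-∀
      identity₂ : ∀ i e → e + (i - + 1) ≡ i + e - + 1
      identity₂ = solve-∀

    agree-residue : ∀ e → e ℕ.< n ℕ.+ n → Agree (+ e)
    agree-residue e e<2n with ℕ.≤-total e n
    ... | inj₁ e≤n = agree-array e e≤n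
    ... | inj₂ n≤e = subst Agree (trans (cong (λ k → + n + + n - k) reflected) (identity (+ n + + n) (+ e)))
                       (agree-mirror₁ _ (agree-array _ 2n∸e≤n))
      where
      2n∸e≤n : n ℕ.+ n ℕ.∸ e ≤ n
      2n∸e≤n = ℕ.≤-trans (ℕ.∸-monoʳ-≤ (n ℕ.+ n) n≤e) (ℕ.≤-reflexive (ℕ.m+n∸n≡m n n))
      reflected : + (n ℕ.+ n ℕ.∸ e) ≡ + n + + n - + e
      reflected = sym (trans (ℤ.m-n≡m⊖n (n ℕ.+ n) e) (ℤ.⊖-≥ (ℕ.<⇒≤ e<2n)))
      identity : ∀ k e → k - (k - e) ≡ e
      identity = solve-∀

    -- The two reflections compose to the translation of widths by `2 n`, in one order upwards and
    -- in the other downwards, so the residues modulo `2 n` suffice. Those up to `n` lie in the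
    -- array and the others are mirror images of them.
    agree : ∀ e → Agree e
    agree e = subst Agree (sym (ℤ.a≡a%ℕn+[a/ℕn]*n e (n ℕ.+ n)))
      (ℤ-induction (λ q → Agree (ρ + q * 2n))
        (subst Agree (sym (ℤ.+-identityʳ ρ)) (agree-residue (e ℤ.%ℕ (n ℕ.+ n)) (ℤ.n%ℕd<d e (n ℕ.+ n))))
        (λ q h → subst Agree (identity₁ ρ q 2n) (agree-mirror₁ _ (agree-mirror₀ _ h)))
        (λ q h → subst Agree (identity₂ ρ q 2n) (agree-mirror₀ _ (agree-mirror₁ _ h)))
        (e ℤ./ℕ (n ℕ.+ n)))
      where
      ρ  = + (e ℤ.%ℕ (n ℕ.+ n))
      2n = + n + + n
      identity₁ : ∀ r q k → k - - (r + q * k) ≡ r + (+ 1 + q) * k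
      identity₁ = solve-∀
      identity₂ : ∀ r q k → - (k - (r + (+ 1 + q) * k)) ≡ r + q * k
      identity₂ = solve-∀

  ℓ≡det : ∀ i j → ℓ i j ≡ det (i - + 1) (j + + 1)
  ℓ≡det i j = begin
    ℓ i j                         ≡⟨ cong (ℓ i) (identity₁ i j) ⟩
    ℓ i (i + e - + 2)             ≡⟨ agree e i ⟩
    det (i - + 1) (i + e - + 1)   ≡⟨ cong (det (i - + 1)) (identity₂ i j) ⟩
    det (i - + 1) (j + + 1)       ∎
    where
    open ≡-Reasoning
    e = j - i + + 2
    identity₁ : ∀ i j → j ≡ i + (j - i + + 2) - + 2
    identity₁ = solve-∀
    identity₂ : ∀ i j → i + (j - i + + 2) - + 1 ≡ j + + 1
    identity₂ = solve-∀

  det-positive : ∀ e u → 1 ≤ e → e ≤ m → + 0 ℤ.< det u (+ e + u)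
  det-positive e u 1≤e e≤m =
    subst (+ 0 ℤ.<_) (row≡det e u (ℕ.m≤n⇒m≤1+n e≤m)) (row-positive e (ℤ.suc u) 1≤e e≤m)

  diagonal-inArray : ∀ i → InArray n i i
  diagonal-inArray i = inArray 2 i i (ℕ.m≤n⇒m≤1+n 2≤m) (ℤ.+-inverseʳ i)

  isPeriod⇒periodic : ∀ {t} → IsPeriod F t → Periodic (+ t)
  isPeriod⇒periodic {t} (_ , per) i =
    trans (extends _ _ (diagonal-inArray (i + + t)))
      (trans (per i i (diagonal-inArray i) (diagonal-inArray (i + + t)))
        (sym (extends _ _ (diagonal-inArray i))))

  -- The quiddity determines the whole frieze: every entry is a determinant, and these are invariant
  -- under translation by a period of the recurrence.
  periodic⇒isPeriod : ∀ {t} → 1 ≤ t → Periodic (+ t) → IsPeriod F t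
  periodic⇒isPeriod {t} 1≤t per = 1≤t , λ i j h h′ → begin
    entry (i + + t) (j + + t) h′                ≡⟨ extends _ _ h′ ⟨
    ℓ (i + + t) (j + + t)                       ≡⟨ ℓ≡det _ _ ⟩
    det (i + + t - + 1) (j + + t + + 1)         ≡⟨ cong₂ det (identity₁ i (+ t)) (identity₂ j (+ t)) ⟩
    det (i - + 1 + + t) (j + + 1 + + t)         ≡⟨ det-shift per _ _ ⟩
    det (i - + 1) (j + + 1)                     ≡⟨ ℓ≡det _ _ ⟨
    ℓ i j                                       ≡⟨ extends _ _ h ⟩
    entry i j h                                 ∎
    where
    open ≡-Reasoning
    identity₁ : ∀ i t → i + t - + 1 ≡ i - + 1 + t
    identity₁ = solve-∀
    identity₂ : ∀ i t → i + t + + 1 ≡ i + + 1 + t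
    identity₂ = solve-∀

  periodic-n : Periodic (+ n)
  periodic-n i = begin
    ℓ (i + + n) (i + + n)                     ≡⟨ ℓ≡det _ _ ⟩
    det (i + + n - + 1) (i + + n + + 1)       ≡⟨ cong₂ det (identity₁ i (+ n)) (identity₂ i (+ n)) ⟩
    det (+ n + (i - + 1)) (+ n + (i + + 1))   ≡⟨ det-antiperiodicˡ _ _ ⟩
    - det (i - + 1) (+ n + (i + + 1))         ≡⟨ cong -_ (det-antiperiodicʳ _ _) ⟩
    - - det (i - + 1) (i + + 1)               ≡⟨ ℤ.neg-involutive _ ⟩
    det (i - + 1) (i + + 1)                   ≡⟨ ℓ≡det _ _ ⟨
    ℓ i i                                     ∎
    where
    open ≡-Reasoning
    identity₁ : ∀ i n → i + n - + 1 ≡ n + (i - + 1)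
    identity₁ = solve-∀
    identity₂ : ∀ i n → i + n + + 1 ≡ n + (i + + 1)
    identity₂ = solve-∀

  -- The two entries subtracted in `growth` are values of `det 0`, which is `y`, and of `det 1`,
  -- which is `- x`. At `k = 0` the right-hand side is the trace of the identity, which explains the
  -- convention `s₀ = 2`.
  growth≡trace : ∀ p k → growth L p k ≡ x (+ (k ℕ.* p)) + y (ℤ.suc (+ (k ℕ.* p)))
  growth≡trace p zero      = refl
  growth≡trace p k@(suc _) = begin
    ℓ (+ 1) c - ℓ (+ 2) (c - + 1)                   ≡⟨ cong₂ _-_ (ℓ≡det _ _) (ℓ≡det _ _) ⟩
    det (+ 0) (c + + 1) - det (+ 1) (c - + 1 + + 1) ≡⟨ cong₂ (λ s t → det (+ 0) s - det (+ 1) t)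
                                                         (ℤ.+-comm c (+ 1)) (identity₁ c) ⟩
    det (+ 0) (ℤ.suc c) - det (+ 1) c
      ≡⟨ cong₂ _-_ (det-basis _ _) (det-basis _ _) ⟩
    (+ 1 * y (ℤ.suc c) - + 0 * x (ℤ.suc c)) - (+ 0 * y c - + 1 * x c)
      ≡⟨ identity₂ (x c) (y c) (x (ℤ.suc c)) (y (ℤ.suc c)) ⟩
    x c + y (ℤ.suc c) ∎
    where
    open ≡-Reasoning
    c = + (k ℕ.* p)
    identity₁ : ∀ c → c - + 1 + + 1 ≡ c
    identity₁ = solve-∀
    identity₂ : ∀ p q r s → (+ 1 * s - + 0 * r) - (+ 0 * q - + 1 * p) ≡ p + s
    identity₂ = solve-∀

-- Growth sequences

cyclic-periodic : ∀ {q} (xs : Vec ℤ (suc q)) k → cyclic xs (k ℕ.+ suc q) ≡ cyclic xs k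
cyclic-periodic {q} xs k = cong (lookup xs)
  (Fin.fromℕ<-cong _ _ (ℕ.[m+n]%n≡m%n k (suc q)) _ _)

-- In each of the three sequences the value 2 occurs once per period, so comparison at index 0
-- refutes every smaller candidate.
sequence₁-leastPeriod : IsLeastPeriodOf sequence₁ 2
sequence₁-leastPeriod = (s≤s z≤n , cyclic-periodic (+ 2 ∷ - + 2 ∷ [])) , λ where
  (suc zero)    (_ , per) → contradiction (per 0) λ ()
  (suc (suc q)) _         → s≤s (s≤s z≤n)

sequence₂-leastPeriod : IsLeastPeriodOf sequence₂ 4
sequence₂-leastPeriod = (s≤s z≤n , cyclic-periodic (+ 2 ∷ + 0 ∷ - + 2 ∷ + 0 ∷ [])) , λ where
  1                         (_ , per) → contradiction (per 0) λ ()
  2                         (_ , per) → contradiction (per 0) λ ()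
  3                         (_ , per) → contradiction (per 0) λ ()
  (suc (suc (suc (suc q)))) _         → s≤s (s≤s (s≤s (s≤s z≤n)))

sequence₃-leastPeriod : IsLeastPeriodOf sequence₃ 6
sequence₃-leastPeriod = (s≤s z≤n , cyclic-periodic (+ 2 ∷ + 1 ∷ - + 1 ∷ - + 2 ∷ - + 1 ∷ + 1 ∷ [])) , λ where
  1 (_ , per) → contradiction (per 0) λ ()
  2 (_ , per) → contradiction (per 0) λ ()
  3 (_ , per) → contradiction (per 0) λ ()
  4 (_ , per) → contradiction (per 0) λ ()
  5 (_ , per) → contradiction (per 0) λ ()
  (suc (suc (suc (suc (suc (suc q)))))) _ → s≤s (s≤s (s≤s (s≤s (s≤s (s≤s z≤n)))))

cyclic-unique : ∀ {q} {s : ℕ → ℤ} (xs : Vec ℤ (suc q)) → (∀ k → s (suc q ℕ.+ k) ≡ s k) →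
                (∀ i → s (toℕ i) ≡ lookup xs i) → s ≗ cyclic xs
cyclic-unique {q} {s} xs per init k = begin
  s k                                          ≡⟨ cong s (ℕ.m≡m%n+[m/n]*n k (suc q)) ⟩
  s (k % suc q ℕ.+ k / suc q ℕ.* suc q)        ≡⟨ cong s (ℕ.+-comm (k % suc q) _) ⟩
  s (k / suc q ℕ.* suc q ℕ.+ k % suc q)        ≡⟨ multiples (k / suc q) (k % suc q) ⟩
  s (k % suc q)                                ≡⟨ cong s (Fin.toℕ-fromℕ< (ℕ.m%n<n k (suc q))) ⟨
  s (toℕ (k mod suc q))                        ≡⟨ init (k mod suc q) ⟩
  cyclic xs k                                  ∎
  where
  open ≡-Reasoning
  multiples : ∀ j k → s (j ℕ.* suc q ℕ.+ k) ≡ s k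
  multiples zero    k = refl
  multiples (suc j) k = trans (cong s (ℕ.+-assoc (suc q) (j ℕ.* suc q) k))
    (trans (per (j ℕ.* suc q ℕ.+ k)) (multiples j k))

Recurrent : ℤ → (ℕ → ℤ) → Set
Recurrent t s = ∀ k → s (2 ℕ.+ k) ≡ t * s (suc k) - s k

-- The characteristic polynomial `(X + 1)²` has a double root, so the recurrence alone does not
-- force periodicity. The initial values enter through `anti`, which is proved together with `per`.
recurrent⇒sequence₁ : ∀ {s} → Recurrent (- + 2) s → s 0 ≡ + 2 → s 1 ≡ - + 2 → s ≗ sequence₁
recurrent⇒sequence₁ {s} rec s₀ s₁ = cyclic-unique {s = s} (+ 2 ∷ - + 2 ∷ []) per λ where
    Fin.zero → s₀ ; (Fin.suc Fin.zero) → s₁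
  where
  identity : ∀ p → - + 2 * - p - p ≡ p
  identity = solve-∀
  anti : ∀ k → s (suc k) ≡ - s k
  per : ∀ k → s (2 ℕ.+ k) ≡ s k
  anti zero    = trans s₁ (cong -_ (sym s₀))
  anti (suc k) = trans (per k) (trans (sym (ℤ.neg-involutive (s k))) (cong -_ (sym (anti k))))
  per k = trans (rec k) (trans (cong (λ p → - + 2 * p - s k) (anti k)) (identity (s k)))

recurrent⇒sequence₂ : ∀ {s} → Recurrent (+ 0) s → s 0 ≡ + 2 → s 1 ≡ + 0 → s ≗ sequence₂
recurrent⇒sequence₂ {s} rec s₀ s₁ = cyclic-unique {s = s} (+ 2 ∷ + 0 ∷ - + 2 ∷ + 0 ∷ []) per λ where
    Fin.zero                               → s₀
    (Fin.suc Fin.zero)                     → s₁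
    (Fin.suc (Fin.suc Fin.zero))           → trans (anti 0) (cong -_ s₀)
    (Fin.suc (Fin.suc (Fin.suc Fin.zero))) → trans (anti 1) (cong -_ s₁)
  where
  identity : ∀ p q → + 0 * p - q ≡ - q
  identity = solve-∀
  anti : ∀ k → s (2 ℕ.+ k) ≡ - s k
  anti k = trans (rec k) (identity (s (suc k)) (s k))
  per : ∀ k → s (4 ℕ.+ k) ≡ s k
  per k = trans (anti (2 ℕ.+ k)) (trans (cong -_ (anti k)) (ℤ.neg-involutive (s k)))

-- The characteristic polynomial `X² - X + 1` divides `X³ + 1`, whence the sign change after three
-- steps.
recurrent⇒sequence₃ : ∀ {s} → Recurrent (+ 1) s → s 0 ≡ + 2 → s 1 ≡ + 1 → s ≗ sequence₃
recurrent⇒sequence₃ {s} rec s₀ s₁ = cyclic-unique {s = s} (+ 2 ∷ + 1 ∷ - + 1 ∷ - + 2 ∷ - + 1 ∷ + 1 ∷ []) per λ where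
    Fin.zero                                                   → s₀
    (Fin.suc Fin.zero)                                         → s₁
    (Fin.suc (Fin.suc Fin.zero))                               → s₂
    (Fin.suc (Fin.suc (Fin.suc Fin.zero)))                     → trans (anti 0) (cong -_ s₀)
    (Fin.suc (Fin.suc (Fin.suc (Fin.suc Fin.zero))))           → trans (anti 1) (cong -_ s₁)
    (Fin.suc (Fin.suc (Fin.suc (Fin.suc (Fin.suc Fin.zero))))) → trans (anti 2) (cong -_ s₂)
  where
  identity : ∀ p q → + 1 * (+ 1 * p - q) - p ≡ - q
  identity = solve-∀
  s₂ : s 2 ≡ - + 1
  s₂ = trans (rec 0) (cong₂ (λ p q → + 1 * p - q) s₁ s₀)
  anti : ∀ k → s (3 ℕ.+ k) ≡ - s k
  anti k = trans (rec (suc k)) (trans (cong (λ p → + 1 * p - s (suc k)) (rec k))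
    (identity (s (suc k)) (s k)))
  per : ∀ k → s (6 ℕ.+ k) ≡ s k
  per k = trans (anti (3 ℕ.+ k)) (trans (cong -_ (anti k)) (ℤ.neg-involutive (s k)))

-- For t ≥ 2 the sequence is increasing, so it has no positive zero.
recurrent-firstZero : ∀ t {c} → Recurrent t c → c 0 ≡ + 0 → ∀ r → 2 ≤ r →
  (∀ k → 1 ≤ k → k ℕ.< r → + 0 ℤ.< c k) → c r ≡ + 0 → (r ≡ 2 × t ≡ + 0) ⊎ (r ≡ 3 × t ≡ + 1)
recurrent-firstZero t {c} rec c₀ r@(suc (suc r′)) (s≤s (s≤s _)) pos c-r = go t refl
  where
  c₁>0 : + 0 ℤ.< c 1
  c₁>0 = pos 1 (s≤s z≤n) (s≤s (s≤s z≤n))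

  c₂ : c 2 ≡ t * c 1
  c₂ = trans (rec 0) (trans (cong (λ p → t * c 1 - p) c₀) (ℤ.+-identityʳ (t * c 1)))

  c₃ : t ≡ + 1 → c 3 ≡ + 0
  c₃ refl = trans (rec 1) (trans (cong (λ p → + 1 * p - c 1) c₂) (identity (c 1)))
    where
    identity : ∀ p → + 1 * (+ 1 * p) - p ≡ + 0
    identity = solve-∀

  -- For `t = 2 + s` the difference of consecutive terms grows by `s * c (suc k)` at each step, so
  -- positivity and monotonicity are carried together.
  increasing : ∀ s → t ≡ + (2 ℕ.+ s) → ∀ k → + 0 ℤ.< c (suc k) × + 0 ℤ.≤ c (suc k) - c k
  increasing s refl zero =
    c₁>0 , subst (λ p → + 0 ℤ.≤ c 1 - p) (sym c₀)
             (subst (+ 0 ℤ.≤_) (sym (ℤ.+-identityʳ (c 1))) (ℤ.<⇒≤ c₁>0))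
  increasing s refl (suc k) with 0<c , 0≤d ← increasing s refl k =
    subst (+ 0 ℤ.<_) (identity′ (c (2 ℕ.+ k)) (c (suc k))) (ℤ.+-mono-≤-< 0≤d′ 0<c) , 0≤d′
    where
    0≤d′ : + 0 ℤ.≤ c (2 ℕ.+ k) - c (suc k)
    0≤d′ = subst (+ 0 ℤ.≤_)
      (sym (trans (cong (_- c (suc k)) (rec k)) (identity (+ s) (c (suc k)) (c k))))
      (ℤ.+-mono-≤ 0≤d (subst (ℤ._≤ + s * c (suc k)) (ℤ.*-zeroʳ (+ s))
        (ℤ.*-monoˡ-≤-nonNeg (+ s) (ℤ.<⇒≤ 0<c))))
      where
      identity : ∀ s p q → ((+ 2 + s) * p - q) - p ≡ (p - q) + s * p
      identity = solve-∀
    identity′ : ∀ p q → (p - q) + q ≡ p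
    identity′ = solve-∀

  positive⇒beyond : ∀ k → 1 ≤ k → ¬ (+ 0 ℤ.< c k) → r ≤ k
  positive⇒beyond k 1≤k c≯0 = ℕ.≮⇒≥ λ k<r → c≯0 (pos k 1≤k k<r)

  go : ∀ s → t ≡ s → (r ≡ 2 × t ≡ + 0) ⊎ (r ≡ 3 × t ≡ + 1)
  go (+ 0) t≡0 = inj₁ (ℕ.≤-antisym (positive⇒beyond 2 (s≤s z≤n) c₂≯0) (s≤s (s≤s z≤n)) , t≡0)
    where
    c₂≯0 : ¬ (+ 0 ℤ.< c 2)
    c₂≯0 = ℤ.<-irrefl (sym (trans c₂ (cong (_* c 1) t≡0)))
  -- Here `c 2 = c 1` is positive, which excludes `r = 2`, and `c 3 = (t² - 1) * c 1` vanishes.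
  go (+ 1) t≡1 = inj₂ (ℕ.≤-antisym (positive⇒beyond 3 (s≤s z≤n) (ℤ.<-irrefl (sym (c₃ t≡1)))) 3≤r , t≡1)
    where
    c₂≡c₁ : c 2 ≡ c 1
    c₂≡c₁ = trans c₂ (trans (cong (_* c 1) t≡1) (ℤ.*-identityˡ (c 1)))
    3≤r : 3 ≤ r
    3≤r = ℕ.≤∧≢⇒< (s≤s (s≤s z≤n)) λ 2≡r →
      ℤ.<-irrefl (sym (trans (sym c₂≡c₁) (trans (cong c 2≡r) c-r))) c₁>0
  go (+ suc (suc s)) t≡2+s =
    contradiction (proj₁ (increasing s t≡2+s (suc r′))) (ℤ.<-irrefl (sym c-r))
  -- `c 2 = t * c 1` would be negative, but index 2 is either before the first zero or equal to it.
  go -[1+ s ] t≡-1-s = contradiction c₂<0 (ℤ.≤⇒≯ c₂≥0)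
    where
    c₂<0 : c 2 ℤ.< + 0
    c₂<0 = subst₂ ℤ._<_ (sym (trans c₂ (cong (_* c 1) t≡-1-s))) (ℤ.*-zeroʳ -[1+ s ])
      (ℤ.*-monoˡ-<-neg -[1+ s ] c₁>0)
    c₂≥0 : + 0 ℤ.≤ c 2
    c₂≥0 with ℕ.m≤n⇒m<n∨m≡n {2} {r} (s≤s (s≤s z≤n))
    ... | inj₁ 2<r = ℤ.<⇒≤ (pos 2 (s≤s z≤n) 2<r)
    ... | inj₂ 2≡r = ℤ.≤-reflexive (sym (trans (cong c 2≡r) c-r))

module GrowthTheory {m : ℕ} (2≤m : 2 ≤ m) {F : Frieze (suc m)} (L : Lattice F)
                    {p : ℕ} (minimal : IsMinimalPeriod F p) where
  open LatticeTheory 2≤m L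

  1≤p : 1 ≤ p
  1≤p = proj₁ (proj₁ minimal)

  instance
    p≢0 : NonZero p
    p≢0 = ℕ.>-nonZero 1≤p

  periodic-p : Periodic (+ p)
  periodic-p = isPeriod⇒periodic (proj₁ minimal)

  period∣ : ∀ t → Periodic (+ t) → p ∣ t
  period∣ t per = m%n≡0⇒n∣m t p (residue (t % p) (ℕ.m%n<n t p)
    (periodic-cancel (periodic-multiple (t / p) periodic-p)
      (subst (Periodic ∘ +_) (ℕ.m≡m%n+[m/n]*n t p) per)))
    where
    residue : ∀ ρ → ρ ℕ.< p → Periodic (+ ρ) → ρ ≡ 0
    residue zero    _   _   = refl
    residue (suc ρ) ρ<p per =
      contradiction (proj₂ minimal (suc ρ) (periodic⇒isPeriod (s≤s z≤n) per)) (ℕ.<⇒≱ ρ<p)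

  -- The offset `j` is there because the trace reads `x` at multiples of `p` but `y` one place
  -- further on.
  solution-recurrent : ∀ {z} → IsSolution z → ∀ j →
                       Recurrent (trace (+ p)) (λ k → z (j + + (k ℕ.* p)))
  solution-recurrent {z} hz j k = trans (cong z (identity j (+ p) (+ (k ℕ.* p))))
    (trans (cayley-hamilton periodic-p hz (j + + (k ℕ.* p)))
      (cong (λ i → trace (+ p) * z i - z (j + + (k ℕ.* p))) (identity′ j (+ p) (+ (k ℕ.* p)))))
    where
    identity : ∀ j p c → j + (p + (p + c)) ≡ j + c + p + p
    identity = solve-∀
    identity′ : ∀ j p c → j + c + p ≡ j + (p + c)
    identity′ = solve-∀

  growth-recurrent : Recurrent (trace (+ p)) (growth L p)
  growth-recurrent k = begin
    growth L p (2 ℕ.+ k)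
      ≡⟨ growth≡ (2 ℕ.+ k) ⟩
    x (+ 0 + + ((2 ℕ.+ k) ℕ.* p)) + y (+ 1 + + ((2 ℕ.+ k) ℕ.* p))
      ≡⟨ cong₂ _+_ (solution-recurrent x-isSolution (+ 0) k) (solution-recurrent y-isSolution (+ 1) k) ⟩
    (t * x₁ - x₀) + (t * y₁ - y₀)
      ≡⟨ identity t x₁ x₀ y₁ y₀ ⟩
    t * (x₁ + y₁) - (x₀ + y₀)
      ≡⟨ cong₂ (λ r s → t * r - s) (growth≡ (suc k)) (growth≡ k) ⟨
    t * growth L p (suc k) - growth L p k ∎
    where
    open ≡-Reasoning
    t = trace (+ p)
    x₀ = x (+ 0 + + (k ℕ.* p))
    x₁ = x (+ 0 + + (suc k ℕ.* p))
    y₀ = y (+ 1 + + (k ℕ.* p))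
    y₁ = y (+ 1 + + (suc k ℕ.* p))
    growth≡ : ∀ k → growth L p k ≡ x (+ 0 + + (k ℕ.* p)) + y (+ 1 + + (k ℕ.* p))
    growth≡ k = trans (growth≡trace p k)
      (cong (λ i → x i + y (ℤ.suc (+ (k ℕ.* p)))) (sym (ℤ.+-identityˡ (+ (k ℕ.* p)))))
    identity : ∀ t a b c d → (t * a - b) + (t * c - d) ≡ t * (a + c) - (b + d)
    identity = solve-∀

  growth-one : growth L p 1 ≡ trace (+ p)
  growth-one = trans (growth≡trace p 1) (cong (trace ∘ +_) (ℕ.*-identityˡ p))

  trace-n : trace (+ n) ≡ - + 2
  trace-n = cong₂ _+_
    (trans (cong x (sym (ℤ.+-identityʳ (+ n)))) (solution-antiperiodic x-isSolution (+ 0)))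
    (trans (cong y (ℤ.+-comm (+ 1) (+ n))) (solution-antiperiodic y-isSolution (+ 1)))

  private
    c : ℕ → ℤ
    c k = y (+ 0 + + (k ℕ.* p))

    det₀ : ∀ i → det (+ 0) i ≡ y i
    det₀ i = trans (det-basis (+ 0) i) (identity (y i) (x i))
      where
      identity : ∀ p q → + 1 * p - + 0 * q ≡ p
      identity = solve-∀

    c-positive : ∀ {k} → 1 ≤ k → k ℕ.* p ≤ m → + 0 ℤ.< c k
    c-positive {k} 1≤k kp≤m = subst (+ 0 ℤ.<_)
      (trans (det₀ _) (cong y (ℤ.+-comm (+ (k ℕ.* p)) (+ 0))))
      (det-positive (k ℕ.* p) (+ 0) (ℕ.*-mono-≤ 1≤k 1≤p) kp≤m)

    c-n : ∀ {r} → n ≡ r ℕ.* p → c r ≡ + 0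
    c-n {r} n≡rp = trans (cong y (trans (ℤ.+-identityˡ (+ (r ℕ.* p)))
        (trans (cong +_ (sym n≡rp)) (sym (ℤ.+-identityʳ (+ n))))))
      (solution-antiperiodic y-isSolution (+ 0))

  order-trace : (n ≡ 1 ℕ.* p × trace (+ p) ≡ - + 2) ⊎
                (n ≡ 2 ℕ.* p × trace (+ p) ≡ + 0) ⊎
                (n ≡ 3 ℕ.* p × trace (+ p) ≡ + 1)
  order-trace = cases (period∣ n periodic-n)
    where
    cases : p ∣ n → (n ≡ 1 ℕ.* p × trace (+ p) ≡ - + 2) ⊎
                    (n ≡ 2 ℕ.* p × trace (+ p) ≡ + 0) ⊎
                    (n ≡ 3 ℕ.* p × trace (+ p) ≡ + 1)
    cases (divides 1 n≡p) =
      inj₁ (n≡p , trans (cong (trace ∘ +_) (trans (sym (ℕ.*-identityˡ p)) (sym n≡p))) trace-n)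
    cases (divides r@(suc (suc _)) n≡rp) = inj₂
      (Sum.map (map₁ order) (map₁ order)
        (recurrent-firstZero (trace (+ p)) {c} (solution-recurrent y-isSolution (+ 0)) refl
          r (s≤s (s≤s z≤n))
          (λ k 1≤k k<r → c-positive 1≤k
            (ℕ.≤-pred (subst (k ℕ.* p ℕ.<_) (sym n≡rp) (ℕ.*-monoˡ-< p k<r))))
          (c-n {r} n≡rp)))
      where
      order : ∀ {k} → r ≡ k → n ≡ k ℕ.* p
      order r≡k = trans n≡rp (cong (ℕ._* p) r≡k)

  growth-trichotomy : (n ≡ 1 ℕ.* p × growth L p ≗ sequence₁) ⊎
                      (n ≡ 2 ℕ.* p × growth L p ≗ sequence₂) ⊎
                      (n ≡ 3 ℕ.* p × growth L p ≗ sequence₃)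
  growth-trichotomy =
    Sum.map (map₂ λ t → recurrent⇒sequence₁ (recurrent t) refl (trans growth-one t))
      (Sum.map (map₂ λ t → recurrent⇒sequence₂ (recurrent t) refl (trans growth-one t))
               (map₂ λ t → recurrent⇒sequence₃ (recurrent t) refl (trans growth-one t)))
      order-trace
    where
    recurrent : ∀ {t} → trace (+ p) ≡ t → Recurrent t (growth L p)
    recurrent t = subst (λ t → Recurrent t (growth L p)) t growth-recurrent

-- Counting pairs

unique-length : ∀ {a} {A : Set a} {xs ys : List A} → Unique xs → Unique ys →
                (∀ {x} → x ∈ xs → x ∈ ys) → (∀ {x} → x ∈ ys → x ∈ xs) → length xs ≡ length ys
unique-length xs! ys! xs⊆ys ys⊆xs = ↭-length (∼bag⇒↭ (unique∧set⇒bag xs! ys! (mk⇔ xs⊆ys ys⊆xs)))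

module _ {n : ℕ} where

  private variable
    p q r : Level
    P : Pred (Fin n × Fin n) p
    Q : Pred (Fin n × Fin n) q
    R : Pred (Fin n × Fin n) r

  pairs : List (Fin n × Fin n)
  pairs = cartesianProduct (allFin n) (allFin n)

  ∈-pairs : ∀ (xy : Fin n × Fin n) → xy ∈ pairs
  ∈-pairs (x , y) = ∈-cartesianProduct⁺ (∈-allFin x) (∈-allFin y)

  pairs! : Unique pairs
  pairs! = Unique.cartesianProduct⁺ (Unique.allFin⁺ n) (Unique.allFin⁺ n)

  -- By definition `trianglesAt T v` is `count (isTriangleAt? T v)`, so triangle counts can be split
  -- and transported by the lemmas below.
  count : ∀ {P : Pred (Fin n × Fin n) p} → Decidable P → ℕ
  count P? = length (filter P? pairs)

  count-empty : (P? : Decidable P) → (∀ xy → ¬ P xy) → count P? ≡ 0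
  count-empty P? ¬P = cong length (filter-none P? (All.universal ¬P pairs))

  count-singleton : (P? : Decidable P) → ∀ xy → P xy → (∀ uv → P uv → uv ≡ xy) → count P? ≡ 1
  count-singleton P? xy Pxy only = unique-length
    (Unique.filter⁺ P? pairs!) (All.[] ∷ [])
    (λ uv∈ → here (only _ (proj₂ (∈-filter⁻ P? {xs = pairs} uv∈))))
    (λ { (here refl) → ∈-filter⁺ P? (∈-pairs xy) Pxy })

  count-⊎ : (P? : Decidable P) (Q? : Decidable Q) (R? : Decidable R) →
            (∀ xy → P xy → Q xy ⊎ R xy) → (∀ xy → Q xy → P xy) → (∀ xy → R xy → P xy) →
            (∀ xy → Q xy → ¬ R xy) → count P? ≡ count Q? ℕ.+ count R?
  count-⊎ P? Q? R? P⊆Q⊎R Q⊆P R⊆P disjoint = go pairs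
    where
    go : ∀ xs → length (filter P? xs) ≡ length (filter Q? xs) ℕ.+ length (filter R? xs)
    go []       = refl
    go (x ∷ xs) with P? x | Q? x | R? x
    ... | yes p | yes q | yes r = contradiction r (disjoint x q)
    ... | yes p | yes q | no ¬r = cong suc (go xs)
    ... | yes p | no ¬q | yes r = trans (cong suc (go xs)) (sym (ℕ.+-suc _ _))
    ... | yes p | no ¬q | no ¬r = contradiction (P⊆Q⊎R x p) [ ¬q , ¬r ]′
    ... | no ¬p | yes q | _     = contradiction (Q⊆P x q) ¬p
    ... | no ¬p | no ¬q | yes r = contradiction (R⊆P x r) ¬p
    ... | no ¬p | no ¬q | no ¬r = go xs

  count-bijection : (P? : Decidable P) (Q? : Decidable Q) (f g : Fin n × Fin n → Fin n × Fin n) →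
                    (∀ xy → g (f xy) ≡ xy) → (∀ xy → f (g xy) ≡ xy) →
                    (∀ xy → P xy → Q (f xy)) → (∀ xy → Q (f xy) → P xy) → count P? ≡ count Q?
  count-bijection {Q = Q} P? Q? f g gf fg P⇒Q Q⇒P = trans (sym (length-map f (filter P? pairs)))
    (unique-length
      (Unique.map⁺ f-injective (Unique.filter⁺ P? pairs!)) (Unique.filter⁺ Q? pairs!)
      to from)
    where
    f-injective : ∀ {x y} → f x ≡ f y → x ≡ y
    f-injective {x} {y} fx≡fy = trans (sym (gf x)) (trans (cong g fx≡fy) (gf y))
    to : ∀ {y} → y ∈ map f (filter P? pairs) → y ∈ filter Q? pairs
    to y∈ with x , x∈ , refl ← ∈-map⁻ f y∈ =
      ∈-filter⁺ Q? (∈-pairs _) (P⇒Q x (proj₂ (∈-filter⁻ P? {xs = pairs} x∈)))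
    from : ∀ {y} → y ∈ filter Q? pairs → y ∈ map f (filter P? pairs)
    from {y} y∈ = subst (_∈ map f (filter P? pairs)) (fg y)
      (∈-map⁺ f (∈-filter⁺ P? (∈-pairs (g y))
        (Q⇒P (g y) (subst Q (sym (fg y)) (proj₂ (∈-filter⁻ Q? {xs = pairs} y∈))))))

-- Rotations and triangulations

module _ {n : ℕ} .{{_ : NonZero n}} where

  toℕ-rotate : ∀ t (v : Fin n) → toℕ (rotate t v) ≡ (toℕ v ℕ.+ t) % n
  toℕ-rotate t v = Fin.toℕ-fromℕ< (ℕ.m%n<n (toℕ v ℕ.+ t) n)

  rotate-+ : ∀ s t (v : Fin n) → rotate s (rotate t v) ≡ rotate (t ℕ.+ s) v
  rotate-+ s t v = Fin.toℕ-injective (begin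
    toℕ (rotate s (rotate t v))              ≡⟨ toℕ-rotate s (rotate t v) ⟩
    (toℕ (rotate t v) ℕ.+ s) % n             ≡⟨ cong (λ w → (w ℕ.+ s) % n) (toℕ-rotate t v) ⟩
    ((toℕ v ℕ.+ t) % n ℕ.+ s) % n            ≡⟨ ℕ.%-distribˡ-+ ((toℕ v ℕ.+ t) % n) s n ⟩
    ((toℕ v ℕ.+ t) % n % n ℕ.+ s % n) % n    ≡⟨ cong (λ w → (w ℕ.+ s % n) % n) (ℕ.m%n%n≡m%n (toℕ v ℕ.+ t) n) ⟩
    ((toℕ v ℕ.+ t) % n ℕ.+ s % n) % n        ≡⟨ ℕ.%-distribˡ-+ (toℕ v ℕ.+ t) s n ⟨
    (toℕ v ℕ.+ t ℕ.+ s) % n                  ≡⟨ cong (_% n) (ℕ.+-assoc (toℕ v) t s) ⟩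
    (toℕ v ℕ.+ (t ℕ.+ s)) % n                ≡⟨ toℕ-rotate (t ℕ.+ s) v ⟨
    toℕ (rotate (t ℕ.+ s) v)                 ∎)
    where open ≡-Reasoning

  rotate-comm : ∀ s t (v : Fin n) → rotate s (rotate t v) ≡ rotate t (rotate s v)
  rotate-comm s t v = trans (rotate-+ s t v)
    (trans (cong (λ k → rotate k v) (ℕ.+-comm t s)) (sym (rotate-+ t s v)))

  rotate-multiple : ∀ k (v : Fin n) → rotate (k ℕ.* n) v ≡ v
  rotate-multiple k v = Fin.toℕ-injective (trans (toℕ-rotate (k ℕ.* n) v)
    (trans (ℕ.[m+kn]%n≡m%n (toℕ v) k n) (ℕ.m<n⇒m%n≡m (Fin.toℕ<n v))))

  -- `t * (n - 1)` is congruent to `- t` modulo `n`, so the inverse is again a rotation by a natural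
  -- number.
  unrotate : ℕ → Fin n → Fin n
  unrotate t = rotate (t ℕ.* ℕ.pred n)

  unrotate-rotate : ∀ t v → unrotate t (rotate t v) ≡ v
  unrotate-rotate t v = trans (rotate-+ (t ℕ.* ℕ.pred n) t v)
    (trans (cong (λ k → rotate k v)
      (trans (sym (ℕ.*-suc t (ℕ.pred n))) (cong (t ℕ.*_) (ℕ.suc-pred n)))) (rotate-multiple t v))

  rotate-unrotate : ∀ t v → rotate t (unrotate t v) ≡ v
  rotate-unrotate t v = trans (rotate-comm t (t ℕ.* ℕ.pred n) v) (unrotate-rotate t v)

  rotate-injective : ∀ t {u v : Fin n} → rotate t u ≡ rotate t v → u ≡ v
  rotate-injective t {u} {v} eq =
    trans (sym (unrotate-rotate t u)) (trans (cong (unrotate t) eq) (unrotate-rotate t v))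

  adjacent-rotate : ∀ t {u v : Fin n} → Adjacent u v → Adjacent (rotate t u) (rotate t v)
  adjacent-rotate t {u} {v} = Sum.map
    (λ v≡ → trans (cong (rotate t) v≡) (rotate-comm t 1 u))
    (λ u≡ → trans (cong (rotate t) u≡) (rotate-comm t 1 v))

  rotate-adjacent : ∀ t {u v : Fin n} → Adjacent (rotate t u) (rotate t v) → Adjacent u v
  rotate-adjacent t {u} {v} = Sum.map
    (λ v≡ → rotate-injective t (trans v≡ (rotate-comm 1 t u)))
    (λ u≡ → rotate-injective t (trans u≡ (rotate-comm 1 t v)))

  isDiagonal-rotate : ∀ t {u v : Fin n} → IsDiagonal u v ⇔ IsDiagonal (rotate t u) (rotate t v)
  isDiagonal-rotate t = mk⇔
    (Product.map (_∘ rotate-injective t) (_∘ rotate-adjacent t))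
    (Product.map (_∘ cong (rotate t)) (_∘ adjacent-rotate t))

  isDiagonal-sym : ∀ {u v : Fin n} → IsDiagonal u v → IsDiagonal v u
  isDiagonal-sym (u≢v , ¬adj) = ≢-sym u≢v , ¬adj ∘ Sum.swap

  toℕ-rotate₁ : ∀ (u : Fin n) → toℕ (rotate 1 u) ≡ suc (toℕ u) ⊎
                (suc (toℕ u) ≡ n × toℕ (rotate 1 u) ≡ 0)
  toℕ-rotate₁ u = Sum.map
    (λ 1+u<n → trans rotate₁ (ℕ.m<n⇒m%n≡m 1+u<n))
    (λ 1+u≡n → 1+u≡n , trans rotate₁ (trans (cong (_% n) 1+u≡n) (ℕ.n%n≡0 n)))
    (ℕ.m≤n⇒m<n∨m≡n (Fin.toℕ<n u))
    where
    rotate₁ : toℕ (rotate 1 u) ≡ suc (toℕ u) % n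
    rotate₁ = trans (toℕ-rotate 1 u) (cong (_% n) (ℕ.+-comm (toℕ u) 1))

  adjacent-< : ∀ {u v : Fin n} → u <ᶠ v → Adjacent u v →
               toℕ v ≡ suc (toℕ u) ⊎ (toℕ u ≡ 0 × suc (toℕ v) ≡ n)
  adjacent-< {u} {v} u<v (inj₁ refl) with toℕ-rotate₁ u
  ... | inj₁ v≡1+u     = inj₁ v≡1+u
  ... | inj₂ (_ , v≡0) = contradiction u<v (ℕ.≤⇒≯ (ℕ.≤-trans (ℕ.≤-reflexive v≡0) z≤n))
  adjacent-< {u} {v} u<v (inj₂ refl) with toℕ-rotate₁ v
  ... | inj₁ u≡1+v         = contradiction u<v (ℕ.<⇒≯ (ℕ.≤-reflexive (sym u≡1+v)))
  ... | inj₂ (1+v≡n , u≡0) = inj₂ (u≡0 , 1+v≡n)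

  crossing-< : ∀ {a b c d : Fin n} → a <ᶠ b → Crossing a b c d →
               ((a <ᶠ c × c <ᶠ b) × (d <ᶠ a ⊎ b <ᶠ d)) ⊎ ((a <ᶠ d × d <ᶠ b) × (c <ᶠ a ⊎ b <ᶠ c))
  crossing-< {a} {b} a<b = Sum.map (Product.map between beyond) (Product.map between beyond)
    where
    between : ∀ {c} → Anticlockwise a c b → a <ᶠ c × c <ᶠ b
    between (inj₁ a<c<b)                = a<c<b
    between (inj₂ (inj₁ (c<b , b<a)))   = contradiction b<a (ℕ.<⇒≯ a<b)
    between (inj₂ (inj₂ (b<a , a<c)))   = contradiction b<a (ℕ.<⇒≯ a<b)
    beyond : ∀ {d} → Anticlockwise b d a → d <ᶠ a ⊎ b <ᶠ d
    beyond (inj₁ (b<d , _))             = inj₂ b<d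
    beyond (inj₂ (inj₁ (d<a , _)))      = inj₁ d<a
    beyond (inj₂ (inj₂ (_ , b<d)))      = inj₂ b<d

  crossing-flip : ∀ {a b c d : Fin n} → Crossing a b c d → Crossing b a c d
  crossing-flip (inj₁ (acb , bda)) = inj₂ (bda , acb)
  crossing-flip (inj₂ (adb , bca)) = inj₁ (bca , adb)

-- Triangles of a triangulation and their numbers at a vertex

module TriangulationTheory {n : ℕ} .{{_ : NonZero n}} (2≤n : 2 ≤ n) (T : Triangulation n) where
  open Triangulation T

  edge-sym : ∀ {u v} → Edge T u v → Edge T v u
  edge-sym = Sum.map Sum.swap symmetric

  edge-irrefl : ∀ {u} → ¬ Edge T u u
  edge-irrefl {u} (inj₁ adj) = rotate₁≢ ([ id , id ]′ adj)
    where
    rotate₁≢ : u ≢ rotate 1 u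
    rotate₁≢ u≡ with toℕ-rotate₁ u
    ... | inj₁ ≡1+u          = ℕ.1+n≢n (trans (sym ≡1+u) (sym (cong toℕ u≡)))
    ... | inj₂ (1+u≡n , ≡0)  = ℕ.<-irrefl
      (trans (cong suc (sym (trans (cong toℕ u≡) ≡0))) 1+u≡n) 2≤n
  edge-irrefl {u} (inj₂ d)   = proj₁ (isDiagonal d) refl

  edge-suc : ∀ {u v} → toℕ v ≡ suc (toℕ u) → Edge T u v
  edge-suc {u} {v} v≡1+u with toℕ-rotate₁ u
  ... | inj₁ ≡1+u        = inj₁ (inj₁ (Fin.toℕ-injective (trans v≡1+u (sym ≡1+u))))
  ... | inj₂ (1+u≡n , _) = contradiction (Fin.toℕ<n v) (ℕ.<-irrefl (trans v≡1+u 1+u≡n))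

  -- Extends `nonCrossing` to the sides of the polygon: a side has all other vertices on one side of
  -- it, so nothing can cross it.
  edges-noncrossing : ∀ {u x w y} → u <ᶠ x → x <ᶠ w → w <ᶠ y → Edge T u w → ¬ Edge T x y
  edges-noncrossing {u} {x} {w} {y} u<x x<w w<y (inj₁ adj) _ with adjacent-< (ℕ.<-trans u<x x<w) adj
  ... | inj₁ w≡1+u       = ℕ.<⇒≱ x<w (ℕ.≤-trans (ℕ.≤-reflexive w≡1+u) u<x)
  ... | inj₂ (_ , 1+w≡n) = ℕ.<⇒≱ (Fin.toℕ<n y) (ℕ.≤-trans (ℕ.≤-reflexive (sym 1+w≡n)) w<y)
  edges-noncrossing {u} {x} {w} {y} u<x x<w w<y (inj₂ _) (inj₁ adj) with adjacent-< (ℕ.<-trans x<w w<y) adj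
  ... | inj₁ y≡1+x     = ℕ.<⇒≱ w<y (ℕ.≤-trans (ℕ.≤-reflexive y≡1+x) x<w)
  ... | inj₂ (x≡0 , _) = ℕ.<⇒≱ u<x (ℕ.≤-trans (ℕ.≤-reflexive x≡0) z≤n)
  edges-noncrossing u<x x<w w<y (inj₂ uw) (inj₂ xy) =
    nonCrossing uw xy (inj₁ (inj₁ (u<x , x<w) , inj₂ (inj₂ (ℕ.<-trans u<x x<w , w<y))))

  -- The apex is the last vertex before w joined to u: maximality of T then
  -- forces it to be joined to w.
  apex : ∀ {u w} → u <ᶠ w → toℕ w ≢ suc (toℕ u) → Edge T u w →
         ∃ λ v → u <ᶠ v × v <ᶠ w × Edge T u v × Edge T v w
  apex {u} {w} u<w w≢1+u uw =
    search first (Fin.>-wellFounded first) (ℕ.≤-reflexive (sym toℕ-first))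
      (ℕ.≤-trans (ℕ.≤-reflexive (cong suc toℕ-first)) 1+u<w) (edge-suc toℕ-first)
    where
    1+u<w : suc (toℕ u) ℕ.< toℕ w
    1+u<w = ℕ.≤∧≢⇒< u<w (w≢1+u ∘ sym)
    first : Fin n
    first = fromℕ< (ℕ.<-trans 1+u<w (Fin.toℕ<n w))
    toℕ-first : toℕ first ≡ suc (toℕ u)
    toℕ-first = Fin.toℕ-fromℕ< _

    last⇒edge : ∀ {v} → u <ᶠ v → v <ᶠ w → Edge T u v →
                (∀ {v′} → v <ᶠ v′ → v′ <ᶠ w → ¬ Edge T u v′) → Edge T v w
    last⇒edge {v} u<v v<w uv last with toℕ w ℕ.≟ suc (toℕ v)
    ... | yes w≡1+v = edge-suc w≡1+v
    ... | no  w≢1+v = inj₂ (maximal (v≢w , ¬adjacent) λ cd crossing → case crossing-< v<w crossing of λ where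
        (inj₁ ((v<c , c<w) , d-outside)) → uncrossed v<c c<w d-outside (inj₂ cd)
        (inj₂ ((v<d , d<w) , c-outside)) → uncrossed v<d d<w c-outside (inj₂ (symmetric cd)))
      where
      v≢w : v ≢ w
      v≢w v≡w = Fin.<⇒≢ v<w v≡w
      ¬adjacent : ¬ Adjacent v w
      ¬adjacent adj with adjacent-< v<w adj
      ... | inj₁ w≡1+v     = w≢1+v w≡1+v
      ... | inj₂ (v≡0 , _) = ℕ.<⇒≱ u<v (ℕ.≤-trans (ℕ.≤-reflexive v≡0) z≤n)
      -- A chord that starts between `v` and `w` and crosses `vw` must then cross `uw` or `uv`, or
      -- end at `u`; the last is impossible because `v` is the last neighbour of `u` before `w`.
      uncrossed : ∀ {c d} → v <ᶠ c → c <ᶠ w → d <ᶠ v ⊎ w <ᶠ d → ¬ Edge T c d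
      uncrossed v<c c<w (inj₂ w<d) cd = edges-noncrossing (ℕ.<-trans u<v v<c) c<w w<d uw cd
      uncrossed {c} {d} v<c c<w (inj₁ d<v) cd with Fin.<-cmp d u
      ... | tri< d<u _ _  = edges-noncrossing d<u (ℕ.<-trans u<v v<c) c<w (edge-sym cd) uw
      ... | tri≈ _ refl _ = last v<c c<w (edge-sym cd)
      ... | tri> _ _ u<d  = edges-noncrossing u<d d<v v<c uv (edge-sym cd)

    search : ∀ v → Acc _>ᶠ_ v → u <ᶠ v → v <ᶠ w → Edge T u v →
             ∃ λ v → u <ᶠ v × v <ᶠ w × Edge T u v × Edge T v w
    search v (acc rs) u<v v<w uv
      with Fin.any? (λ v′ → (v Fin.<? v′) ×-dec (v′ Fin.<? w) ×-dec edge? T u v′)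
    ... | yes (v′ , v<v′ , v′<w , uv′) = search v′ (rs v<v′) (ℕ.<-trans u<v v<v′) v′<w uv′
    ... | no  none = v , u<v , v<w , uv ,
      last⇒edge u<v v<w uv λ v<v′ v′<w uv′ → none (_ , v<v′ , v′<w , uv′)

  -- The numbers of triangles of the polygon with vertices u, u + 1, …, w at its
  -- first and at its last vertex.
  AtFirst AtLast : Fin n → Fin n → Pred (Fin n × Fin n) _
  AtFirst u w xy@(x , y) = IsTriangleAt T u xy × u <ᶠ x × y ≤ᶠ w
  AtLast  u w xy@(x , y) = IsTriangleAt T w xy × u ≤ᶠ x × y <ᶠ w

  atFirst? : ∀ u w → Decidable (AtFirst u w)
  atFirst? u w xy@(x , y) = isTriangleAt? T u xy ×-dec (u Fin.<? x) ×-dec (y Fin.≤? w)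

  atLast? : ∀ u w → Decidable (AtLast u w)
  atLast? u w xy@(x , y) = isTriangleAt? T w xy ×-dec (u Fin.≤? x) ×-dec (y Fin.<? w)

  α β : Fin n → Fin n → ℕ
  α u w = count (atFirst? u w)
  β u w = count (atLast? u w)

  α-side : ∀ {u w} → toℕ w ≡ suc (toℕ u) → α u w ≡ 0
  α-side {u} {w} w≡1+u = count-empty (atFirst? u w) λ (x , y) ((x<y , _) , u<x , y≤w) →
    ℕ.<⇒≱ x<y (ℕ.≤-trans y≤w (ℕ.≤-trans (ℕ.≤-reflexive w≡1+u) u<x))

  β-side : ∀ {u w} → toℕ w ≡ suc (toℕ u) → β u w ≡ 0
  β-side {u} {w} w≡1+u = count-empty (atLast? u w) λ (x , y) ((x<y , _) , u≤x , y<w) →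
    ℕ.<⇒≱ (ℕ.<-≤-trans x<y (ℕ.≤-pred (ℕ.≤-trans y<w (ℕ.≤-reflexive w≡1+u)))) u≤x

  module _ {u v w : Fin n} (u<v : u <ᶠ v) (v<w : v <ᶠ w)
           (uv : Edge T u v) (vw : Edge T v w) (uw : Edge T u w) where
    private
      ≟pair : ∀ (ab : Fin n × Fin n) → Decidable (_≡ ab)
      ≟pair ab xy = ≡-dec Fin._≟_ Fin._≟_ xy ab

      count-≟ : ∀ ab → count (≟pair ab) ≡ 1
      count-≟ ab = count-singleton (≟pair ab) ab refl λ _ e → e

    -- The triangle `u v w` cuts the polygon from `u` to `w` into the polygons from `u` to `v` and
    -- from `v` to `w`, and only the first of them contains `u`. Any other triangle at `u` would
    -- have an edge crossing `uv` or `vw`.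
    α-apex : α u w ≡ suc (α u v)
    α-apex = trans
      (count-⊎ (atFirst? u w) (≟pair (v , w)) (atFirst? u v) split
        (λ { _ refl → (v<w , uv , uw , vw) , u<v , ℕ.≤-refl })
        (λ _ (tri , u<x , y≤v) → tri , u<x , ℕ.≤-trans y≤v (ℕ.<⇒≤ v<w))
        (λ { _ refl (_ , _ , w≤v) → ℕ.<⇒≱ v<w w≤v }))
      (cong (ℕ._+ α u v) (count-≟ (v , w)))
      where
      split : ∀ xy → AtFirst u w xy → xy ≡ (v , w) ⊎ AtFirst u v xy
      split (x , y) (tri@(x<y , ux , uy , xy) , u<x , y≤w) with ℕ.≤-<-connex (toℕ y) (toℕ v)
      ... | inj₁ y≤v = inj₂ (tri , u<x , y≤v)
      ... | inj₂ v<y with ℕ.m≤n⇒m<n∨m≡n y≤w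
      ...   | inj₁ y<w = contradiction vw (edges-noncrossing u<v v<y y<w uy)
      ...   | inj₂ y≡w with refl ← Fin.toℕ-injective y≡w with Fin.<-cmp x v
      ...     | tri< x<v _ _  = contradiction xy (edges-noncrossing u<x x<v v<w uv)
      ...     | tri≈ _ refl _ = inj₁ refl
      ...     | tri> _ _ v<x  = contradiction vw (edges-noncrossing u<v v<x x<y ux)

    β-apex : β u w ≡ suc (β v w)
    β-apex = trans
      (count-⊎ (atLast? u w) (≟pair (u , v)) (atLast? v w) split
        (λ { _ refl → (u<v , edge-sym uw , edge-sym vw , uv) , ℕ.≤-refl , v<w })
        (λ _ (tri , v≤x , y<w) → tri , ℕ.≤-trans (ℕ.<⇒≤ u<v) v≤x , y<w)
        (λ { _ refl (_ , v≤u , _) → ℕ.<⇒≱ u<v v≤u }))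
      (cong (ℕ._+ β v w) (count-≟ (u , v)))
      where
      split : ∀ xy → AtLast u w xy → xy ≡ (u , v) ⊎ AtLast v w xy
      split (x , y) (tri@(x<y , wx , wy , xy) , u≤x , y<w) with ℕ.≤-<-connex (toℕ v) (toℕ x)
      ... | inj₁ v≤x = inj₂ (tri , v≤x , y<w)
      ... | inj₂ x<v with ℕ.m≤n⇒m<n∨m≡n u≤x
      ...   | inj₁ u<x = contradiction (edge-sym wx) (edges-noncrossing u<x x<v v<w uv)
      ...   | inj₂ u≡x with refl ← Fin.toℕ-injective u≡x with Fin.<-cmp y v
      ...     | tri< y<v _ _  = contradiction (edge-sym wy) (edges-noncrossing x<y y<v v<w uv)
      ...     | tri≈ _ refl _ = inj₁ refl
      ...     | tri> _ _ v<y  = contradiction vw (edges-noncrossing u<v v<y y<w xy)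

    -- The edge `uw` confines all neighbours of `v` to the range from `u` to `w`. The triangles at
    -- `v` are thus those of the polygon ending at `v`, the triangle `u v w`, and those of the
    -- polygon beginning at `v`.
    trianglesAt-apex : trianglesAt T v ≡ β u v ℕ.+ suc (α v w)
    trianglesAt-apex = trans
      (count-⊎ (isTriangleAt? T v) (atLast? u v) rest? split₁ (λ _ → proj₁) (λ _ → proj₁)
        (λ _ (_ , _ , y<v) (_ , v≤y) → ℕ.<⇒≱ y<v v≤y))
      (cong (β u v ℕ.+_) (trans
        (count-⊎ rest? (≟pair (u , w)) (atFirst? v w) split₂
          (λ { _ refl → (ℕ.<-trans u<v v<w , edge-sym uv , vw , uw) , ℕ.<⇒≤ v<w })
          (λ _ (tri , v<x , _) → tri , ℕ.<⇒≤ (ℕ.<-trans v<x (proj₁ tri)))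
          (λ { _ refl (_ , v<u , _) → ℕ.<⇒≱ v<u (ℕ.<⇒≤ u<v) }))
        (cong (ℕ._+ α v w) (count-≟ (u , w)))))
      where
      Rest : Pred (Fin n × Fin n) _
      Rest xy@(x , y) = IsTriangleAt T v xy × v ≤ᶠ y
      rest? : Decidable Rest
      rest? xy@(x , y) = isTriangleAt? T v xy ×-dec (v Fin.≤? y)

      lower : ∀ {x} → Edge T v x → u ≤ᶠ x
      lower vx = ℕ.≮⇒≥ λ x<u → edges-noncrossing x<u u<v v<w (edge-sym vx) uw
      upper : ∀ {y} → Edge T v y → y ≤ᶠ w
      upper vy = ℕ.≮⇒≥ λ w<y → edges-noncrossing u<v v<w w<y uw vy

      split₁ : ∀ xy → IsTriangleAt T v xy → AtLast u v xy ⊎ Rest xy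
      split₁ (x , y) tri@(_ , vx , _) with ℕ.≤-<-connex (toℕ v) (toℕ y)
      ... | inj₁ v≤y = inj₂ (tri , v≤y)
      ... | inj₂ y<v = inj₁ (tri , lower vx , y<v)

      split₂ : ∀ xy → Rest xy → xy ≡ (u , w) ⊎ AtFirst v w xy
      split₂ (x , y) (tri@(x<y , vx , vy , xy) , v≤y) with Fin.<-cmp x v
      ... | tri≈ _ refl _ = contradiction vx edge-irrefl
      ... | tri> _ _ v<x  = inj₂ (tri , v<x , upper vy)
      ... | tri< x<v _ _ with ℕ.m≤n⇒m<n∨m≡n v≤y
      ...   | inj₂ v≡y with refl ← Fin.toℕ-injective v≡y = contradiction vy edge-irrefl
      ...   | inj₁ v<y with ℕ.m≤n⇒m<n∨m≡n (lower vx) | ℕ.m≤n⇒m<n∨m≡n (upper vy)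
      ...     | inj₁ u<x | _        = contradiction xy (edges-noncrossing u<x x<v v<y uv)
      ...     | inj₂ _   | inj₁ y<w = contradiction vw (edges-noncrossing x<v v<y y<w xy)
      ...     | inj₂ u≡x | inj₂ y≡w =
        inj₁ (cong₂ _,_ (sym (Fin.toℕ-injective u≡x)) (Fin.toℕ-injective y≡w))

  module _ {t : ℕ} (preserves : Preserves T t) where

    edge-rotate : ∀ {u v} → Edge T u v ⇔ Edge T (rotate t u) (rotate t v)
    edge-rotate {u} {v} = mk⇔
      (Sum.map (adjacent-rotate t) (Equivalence.to (preserves u v)))
      (Sum.map (rotate-adjacent t) (Equivalence.from (preserves u v)))

  -- Ordered pairs, unlike the increasing ones in IsTriangleAt, are permuted by
  -- the rotations.
  OrderedTriangleAt : Fin n → Pred (Fin n × Fin n) _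
  OrderedTriangleAt v (x , y) = Edge T v x × Edge T v y × Edge T x y

  orderedTriangleAt? : ∀ v → Decidable (OrderedTriangleAt v)
  orderedTriangleAt? v (x , y) = edge? T v x ×-dec edge? T v y ×-dec edge? T x y

  count-ordered : ∀ v → count (orderedTriangleAt? v) ≡ trianglesAt T v ℕ.+ trianglesAt T v
  count-ordered v = trans
    (count-⊎ (orderedTriangleAt? v) (isTriangleAt? T v) decreasing? split (λ _ → proj₂)
      (λ (x , y) (_ , vy , vx , yx) → vx , vy , edge-sym yx)
      (λ _ (x<y , _) (y<x , _) → ℕ.<⇒≯ x<y y<x))
    (cong (trianglesAt T v ℕ.+_)
      (count-bijection decreasing? (isTriangleAt? T v) swap swap
        (λ _ → refl) (λ _ → refl) (λ _ d → d) (λ _ d → d)))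
    where
    decreasing? : Decidable (IsTriangleAt T v ∘ swap)
    decreasing? = isTriangleAt? T v ∘ swap
    split : ∀ xy → OrderedTriangleAt v xy → IsTriangleAt T v xy ⊎ IsTriangleAt T v (swap xy)
    split (x , y) (vx , vy , xy) with Fin.<-cmp x y
    ... | tri< x<y _ _  = inj₁ (x<y , vx , vy , xy)
    ... | tri≈ _ refl _ = contradiction xy edge-irrefl
    ... | tri> _ _ y<x  = inj₂ (y<x , vy , vx , edge-sym xy)

  trianglesAt-rotate : ∀ {t} → Preserves T t → ∀ v → trianglesAt T (rotate t v) ≡ trianglesAt T v
  trianglesAt-rotate {t} preserves v = halve (begin
    trianglesAt T (rotate t v) ℕ.+ trianglesAt T (rotate t v)  ≡⟨ count-ordered (rotate t v) ⟨
    count (orderedTriangleAt? (rotate t v))                    ≡⟨ invariant ⟨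
    count (orderedTriangleAt? v)                               ≡⟨ count-ordered v ⟩
    trianglesAt T v ℕ.+ trianglesAt T v                        ∎)
    where
    open ≡-Reasoning
    edge = edge-rotate preserves
    invariant : count (orderedTriangleAt? v) ≡ count (orderedTriangleAt? (rotate t v))
    invariant = count-bijection (orderedTriangleAt? v) (orderedTriangleAt? (rotate t v))
      (Product.map (rotate t) (rotate t)) (Product.map (unrotate t) (unrotate t))
      (λ (x , y) → cong₂ _,_ (unrotate-rotate t x) (unrotate-rotate t y))
      (λ (x , y) → cong₂ _,_ (rotate-unrotate t x) (rotate-unrotate t y))
      (λ _ (vx , vy , xy) → Equivalence.to edge vx , Equivalence.to edge vy , Equivalence.to edge xy)
      (λ _ (vx , vy , xy) → Equivalence.from edge vx , Equivalence.from edge vy , Equivalence.from edge xy)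
    halve : ∀ {a b} → a ℕ.+ a ≡ b ℕ.+ b → a ≡ b
    halve {a} {b} eq = ℕ.*-cancelˡ-≡ a b 2 (trans (double a) (trans eq (sym (double b))))
      where
      double : ∀ a → 2 ℕ.* a ≡ a ℕ.+ a
      double a = cong (a ℕ.+_) (ℕ.+-identityʳ a)

-- Triangulations and friezes

module AssociatedTriangulation
  {m : ℕ} (2≤m : 2 ≤ m) {F : Frieze (suc m)} (L : Lattice F)
  (T : Triangulation (suc m)) (associated : IsAssociatedTo T F) where

  open LatticeTheory 2≤m L
  open IsSolution
  open Lattice L
  open Triangulation T
  open TriangulationTheory (ℕ.m≤n⇒m≤1+n 2≤m) T

  label : Fin n → ℤ
  label v = + suc (toℕ v)

  quiddity≡trianglesAt : ∀ v → quiddity (label v) ≡ + trianglesAt T v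
  quiddity≡trianglesAt v =
    trans (extends _ _ (diagonal-inArray (label v))) (associated v (diagonal-inArray (label v)))

  module _ {z : ℤ → ℤ} (hz : IsSolution z) where

    -- The recurrence of the polygon `u , … , w` closed up by the edge `uw`, at its two ends. There
    -- `α u w` and `β u w` serve as quiddity, `w` precedes `u` and `u` follows `w`, and
    -- antiperiodicity around the smaller polygon would give these wrapped values a minus sign, here
    -- moved across the equation. The argument `+ toℕ w` is the index before `label w`.
    Fan : Fin n → Fin n → Set
    Fan u w = z (ℤ.suc (label u)) ≡ + α u w * z (label u) + z (label w) ×
              z (+ toℕ w) ≡ + β u w * z (label w) + z (label u)

    fan-apex : ∀ {u v w} → u <ᶠ v → v <ᶠ w → Edge T u v → Edge T v w → Edge T u w →
               Fan u v → Fan v w → Fan u w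
    fan-apex {u} {v} {w} u<v v<w uv vw uw (uv-first , uv-last) (vw-first , vw-last) =
      (begin
        z (ℤ.suc (label u))
          ≡⟨ uv-first ⟩
        + α u v * z (label u) + z (label v)
          ≡⟨ cong (_+_ (+ α u v * z (label u))) middle ⟩
        + α u v * z (label u) + (z (label u) + z (label w))
          ≡⟨ identity₁ (+ α u v) (z (label u)) (z (label w)) ⟩
        + suc (α u v) * z (label u) + z (label w)
          ≡⟨ cong (λ k → + k * z (label u) + z (label w))
               (α-apex u<v v<w uv vw uw) ⟨
        + α u w * z (label u) + z (label w) ∎) ,
      (begin
        z (+ toℕ w)
          ≡⟨ vw-last ⟩
        + β v w * z (label w) + z (label v)
          ≡⟨ cong (_+_ (+ β v w * z (label w)))
               (trans middle (ℤ.+-comm (z (label u)) (z (label w)))) ⟩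
        + β v w * z (label w) + (z (label w) + z (label u))
          ≡⟨ identity₁ (+ β v w) (z (label w)) (z (label u)) ⟩
        + suc (β v w) * z (label w) + z (label u)
          ≡⟨ cong (λ k → + k * z (label w) + z (label u))
               (β-apex u<v v<w uv vw uw) ⟨
        + β u w * z (label w) + z (label u) ∎)
      where
      open ≡-Reasoning
      identity₁ : ∀ k p q → k * p + (p + q) ≡ (+ 1 + k) * p + q
      identity₁ = solve-∀
      identity₂ : ∀ k l p q r → k * p + q + (l * p + r) ≡ (l + k) * p + (r + q)
      identity₂ = solve-∀
      identity₃ : ∀ k l p → (l + k) * p + p ≡ (l + (+ 1 + k)) * p
      identity₃ = solve-∀
      -- The two fans meeting at `v` involve all triangles at `v` except `u v w`. Comparing their
      -- sum with the recurrence at `v`, whose coefficient counts that triangle too, leaves exactly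
      -- one `z (label v)`.
      middle : z (label v) ≡ z (label u) + z (label w)
      middle = sym (AbelianGroup.∙-cancelˡ ℤ.+-0-abelianGroup ((+ β u v + + α v w) * z (label v)) _ _ (begin
        (+ β u v + + α v w) * z (label v) + (z (label u) + z (label w))
          ≡⟨ identity₂ (+ α v w) (+ β u v) (z (label v)) (z (label w)) (z (label u)) ⟨
        + α v w * z (label v) + z (label w) + (+ β u v * z (label v) + z (label u))
          ≡⟨ cong₂ _+_ vw-first uv-last ⟨
        z (ℤ.suc (label v)) + z (+ toℕ v)
          ≡⟨ step hz (+ toℕ v) ⟩
        quiddity (label v) * z (label v)
          ≡⟨ cong (_* z (label v)) (trans (quiddity≡trianglesAt v)
               (cong +_ (trianglesAt-apex u<v v<w uv vw uw))) ⟩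
        + (β u v ℕ.+ suc (α v w)) * z (label v)
          ≡⟨ identity₃ (+ α v w) (+ β u v) (z (label v)) ⟨
        (+ β u v + + α v w) * z (label v) + z (label v) ∎))

    fan-side : ∀ {u w} → toℕ w ≡ suc (toℕ u) → Fan u w
    fan-side {u} {w} w≡1+u =
      trans (cong (λ k → z (+ suc k)) (sym w≡1+u))
        (sym (zero-* (α u w) (α-side {u} {w} w≡1+u) (z (label u)) (z (label w)))) ,
      trans (cong (λ k → z (+ k)) w≡1+u)
        (sym (zero-* (β u w) (β-side {u} {w} w≡1+u) (z (label w)) (z (label u))))
      where
      zero-* : ∀ k → k ≡ 0 → ∀ p q → + k * p + q ≡ q
      zero-* k refl p q = ℤ.+-identityˡ q

    fan : ∀ {u w} → u <ᶠ w → Edge T u w → Fan u w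
    fan {u} {w} = go (toℕ w) (ℕ.m≤m+n (toℕ w) (toℕ u))
      where
      go : ∀ k {u w} → toℕ w ≤ k ℕ.+ toℕ u → u <ᶠ w → Edge T u w → Fan u w
      go zero    w≤u u<w _ = contradiction w≤u (ℕ.<⇒≱ u<w)
      go (suc k) {u} {w} w≤1+k+u u<w uw with toℕ w ℕ.≟ suc (toℕ u)
      ... | yes w≡1+u = fan-side w≡1+u
      ... | no  w≢1+u with v , u<v , v<w , uv , vw ← apex u<w w≢1+u uw =
        fan-apex u<v v<w uv vw uw
          (go k (ℕ.≤-pred (ℕ.≤-trans v<w w≤1+k+u)) u<v uv)
          (go k (ℕ.≤-trans w≤1+k+u (ℕ.≤-trans (ℕ.≤-reflexive (sym (ℕ.+-suc k (toℕ u)))) (ℕ.+-monoʳ-≤ k u<v))) v<w vw)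

  -- The first fan relation is applied to the solution that vanishes at `u` and is 1 at `u + 1`, so
  -- the triangle count drops out.
  det-edge : ∀ {u w} → u <ᶠ w → Edge T u w → det (label u) (label w) ≡ + 1
  det-edge {u} {w} u<w uw = begin
    det (label u) (label w)
      ≡⟨ ℤ.+-identityˡ _ ⟨
    + 0 + det (label u) (label w)
      ≡⟨ cong (_+ det (label u) (label w)) (ℤ.*-zeroʳ (+ α u w)) ⟨
    + α u w * + 0 + det (label u) (label w)
      ≡⟨ cong (λ d → + α u w * d + det (label u) (label w)) (det-self (label u)) ⟨
    + α u w * det (label u) (label u) + det (label u) (label w)
      ≡⟨ proj₁ (fan (det-isSolution (label u)) u<w uw) ⟨
    det (label u) (ℤ.suc (label u))
      ≡⟨ det-suc (label u) ⟩
    + 1 ∎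
    where open ≡-Reasoning

  det-label-positive : ∀ {u v} → u <ᶠ v → + 0 ℤ.< det (label u) (label v)
  det-label-positive {u} {v} u<v = subst (λ w → + 0 ℤ.< det (label u) w)
    (cong +_ (trans (ℕ.+-suc (toℕ v ℕ.∸ toℕ u) (toℕ u)) (cong suc (ℕ.m∸n+n≡m (ℕ.<⇒≤ u<v)))))
    (det-positive (toℕ v ℕ.∸ toℕ u) (label u) (ℕ.m<n⇒0<n∸m u<v)
      (ℕ.≤-trans (ℕ.m∸n≤m (toℕ v) (toℕ u)) (ℕ.≤-pred (Fin.toℕ<n v))))

  -- Absolute values make ∣det∣ invariant under the antiperiod n.
  ∣det∣ : ℤ → ℤ → ℕ
  ∣det∣ u v = ℤ.∣ det u v ∣

  ∣det∣-sym : ∀ u v → ∣det∣ u v ≡ ∣det∣ v u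
  ∣det∣-sym u v = trans (cong ℤ.∣_∣ (det-antisym u v)) (ℤ.∣-i∣≡∣i∣ (det v u))

  ∣det∣-multipleˡ : ∀ k u v → ∣det∣ (+ (k ℕ.* n) + u) v ≡ ∣det∣ u v
  ∣det∣-multipleˡ zero    u v = cong (λ u → ∣det∣ u v) (ℤ.+-identityˡ u)
  ∣det∣-multipleˡ (suc k) u v = trans
    (cong (λ u → ∣det∣ u v) (ℤ.+-assoc (+ n) (+ (k ℕ.* n)) u))
    (trans (cong ℤ.∣_∣ (det-antiperiodicˡ (+ (k ℕ.* n) + u) v))
      (trans (ℤ.∣-i∣≡∣i∣ (det (+ (k ℕ.* n) + u) v)) (∣det∣-multipleˡ k u v)))

  ∣det∣-multiple : ∀ k l u v → ∣det∣ (+ (k ℕ.* n) + u) (+ (l ℕ.* n) + v) ≡ ∣det∣ u v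
  ∣det∣-multiple k l u v = trans (∣det∣-multipleˡ k u _)
    (trans (∣det∣-sym u _) (trans (∣det∣-multipleˡ l v u) (∣det∣-sym v u)))

  label-rotate : ∀ t v → label v + + t ≡ + ((toℕ v ℕ.+ t) / n ℕ.* n) + label (rotate t v)
  label-rotate t v = cong +_ (begin
    suc (toℕ v ℕ.+ t)                                  ≡⟨ cong suc (ℕ.m≡m%n+[m/n]*n (toℕ v ℕ.+ t) n) ⟩
    suc ((toℕ v ℕ.+ t) % n ℕ.+ q)                      ≡⟨ cong suc (ℕ.+-comm _ q) ⟩
    suc (q ℕ.+ (toℕ v ℕ.+ t) % n)                      ≡⟨ ℕ.+-suc q _ ⟨
    q ℕ.+ suc ((toℕ v ℕ.+ t) % n)                      ≡⟨ cong (λ r → q ℕ.+ suc r) (toℕ-rotate t v) ⟨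
    q ℕ.+ suc (toℕ (rotate t v))                       ∎)
    where
    open ≡-Reasoning
    q = (toℕ v ℕ.+ t) / n ℕ.* n

  Unit : Fin n → Fin n → Set
  Unit u v = ∣det∣ (label u) (label v) ≡ 1

  unit-sym : ∀ {u v} → Unit u v → Unit v u
  unit-sym {u} {v} = trans (∣det∣-sym (label v) (label u))

  unit-rotate : ∀ {t} → Periodic (+ t) → ∀ u v →
                ∣det∣ (label (rotate t u)) (label (rotate t v)) ≡ ∣det∣ (label u) (label v)
  unit-rotate {t} per u v = begin
    ∣det∣ (label (rotate t u)) (label (rotate t v))
      ≡⟨ ∣det∣-multiple ((toℕ u ℕ.+ t) / n) ((toℕ v ℕ.+ t) / n) (label (rotate t u)) (label (rotate t v)) ⟨
    ∣det∣ (+ ((toℕ u ℕ.+ t) / n ℕ.* n) + label (rotate t u)) (+ ((toℕ v ℕ.+ t) / n ℕ.* n) + label (rotate t v))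
      ≡⟨ cong₂ ∣det∣ (label-rotate t u) (label-rotate t v) ⟨
    ∣det∣ (label u + + t) (label v + + t)
      ≡⟨ cong ℤ.∣_∣ (det-shift per (label u) (label v)) ⟩
    ∣det∣ (label u) (label v) ∎
    where open ≡-Reasoning

  diag⇒unit : ∀ {u v} → Diag u v → Unit u v
  diag⇒unit {u} {v} uv with Fin.<-cmp u v
  ... | tri< u<v _ _  = cong ℤ.∣_∣ (det-edge u<v (inj₂ uv))
  ... | tri≈ _ u≡v _  = contradiction u≡v (proj₁ (isDiagonal uv))
  ... | tri> _ _ v<u  = unit-sym {v} {u} (cong ℤ.∣_∣ (det-edge v<u (inj₂ (symmetric uv))))

  -- In Ptolemy's relation the right-hand side is at least 2.
  units-noncrossing : ∀ {s t u v} → s <ᶠ t → t <ᶠ u → u <ᶠ v → Unit s u → ¬ Unit t v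
  units-noncrossing {s} {t} {u} {v} s<t t<u u<v su tv = ℤ.<-irrefl refl
    (subst (+ 1 ℤ.<_)
      (trans (sym (plücker (label s) (label t) (label u) (label v)))
        (cong₂ _*_ (unit (ℕ.<-trans s<t t<u) su) (unit (ℕ.<-trans t<u u<v) tv)))
      (ℤ.+-mono-≤-< (ℤ.i<j⇒suc[i]≤j (positive-* s<t u<v))
                    (positive-* (ℕ.<-trans s<t (ℕ.<-trans t<u u<v)) t<u)))
    where
    unit : ∀ {a b} → a <ᶠ b → Unit a b → det (label a) (label b) ≡ + 1
    unit a<b ab = trans (sym (ℤ.0≤i⇒+∣i∣≡i (ℤ.<⇒≤ (det-label-positive a<b)))) (cong +_ ab)
    positive-* : ∀ {a b c d} → a <ᶠ b → c <ᶠ d →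
                 + 0 ℤ.< det (label a) (label b) * det (label c) (label d)
    positive-* {a} {b} {c} {d} a<b c<d = subst (ℤ._< dab * dcd) (ℤ.*-zeroʳ dab)
      (ℤ.*-monoˡ-<-pos dab {{ℤ.positive (det-label-positive a<b)}} (det-label-positive c<d))
      where
      dab = det (label a) (label b)
      dcd = det (label c) (label d)

  units-uncrossed : ∀ {a b c d} → a <ᶠ b → Unit a b → Unit c d → ¬ Crossing a b c d
  units-uncrossed {c = c} {d} a<b ab cd crossing = case crossing-< a<b crossing of λ where
    (inj₁ ((a<c , c<b) , inj₁ d<a)) → units-noncrossing d<a a<c c<b (unit-sym {c} {d} cd) ab
    (inj₁ ((a<c , c<b) , inj₂ b<d)) → units-noncrossing a<c c<b b<d ab cd
    (inj₂ ((a<d , d<b) , inj₁ c<a)) → units-noncrossing c<a a<d d<b cd ab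
    (inj₂ ((a<d , d<b) , inj₂ b<c)) → units-noncrossing a<d d<b b<c ab (unit-sym {c} {d} cd)

  -- All diagonals of `T` are units, and units do not cross, so maximality of `T` applies. Sides are
  -- units too, hence the first hypothesis.
  unit⇒diag : ∀ {a b} → IsDiagonal a b → Unit a b → Diag a b
  unit⇒diag {a} {b} ab-diagonal ab with Fin.<-cmp a b
  ... | tri< a<b _ _  = maximal ab-diagonal λ cd → units-uncrossed a<b ab (diag⇒unit cd)
  ... | tri≈ _ a≡b _  = contradiction a≡b (proj₁ ab-diagonal)
  ... | tri> _ _ b<a  = symmetric (maximal (isDiagonal-sym ab-diagonal)
    λ cd → units-uncrossed b<a (unit-sym {a} {b} ab) (diag⇒unit cd))

  periodic⇒preserves : ∀ {t} → Periodic (+ t) → Preserves T t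
  periodic⇒preserves {t} per u v = mk⇔
    (λ uv → unit⇒diag (Equivalence.to (isDiagonal-rotate t) (isDiagonal uv))
              (trans (unit-rotate per u v) (diag⇒unit uv)))
    (λ uv → unit⇒diag (Equivalence.from (isDiagonal-rotate t) (isDiagonal uv))
              (trans (sym (unit-rotate per u v)) (diag⇒unit uv)))

  quiddity-multiple : ∀ k i → quiddity (i + k * + n) ≡ quiddity i
  quiddity-multiple = ℤ-induction _ (λ i → cong quiddity (ℤ.+-identityʳ i))
    (λ k ih i → trans (cong quiddity (identity i k (+ n))) (trans (periodic-n _) (ih i)))
    (λ k ih i → trans (sym (periodic-n _)) (trans (cong quiddity (sym (identity i k (+ n)))) (ih i)))
    where
    identity : ∀ i k n → i + (+ 1 + k) * n ≡ i + k * n + n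
    identity = solve-∀

  -- On the labels the quiddity counts triangles, and a symmetry preserves these counts;
  -- `n`-periodicity carries this to all integers.
  preserves⇒periodic : ∀ {t} → Preserves T t → Periodic (+ t)
  preserves⇒periodic {t} preserves i = begin
    quiddity (i + + t)
      ≡⟨ cong quiddity (trans (cong (_+ + t) i≡) (identity (label v) (q * + n) (+ t))) ⟩
    quiddity (label v + + t + q * + n)
      ≡⟨ quiddity-multiple q (label v + + t) ⟩
    quiddity (label v + + t)
      ≡⟨ cong quiddity (trans (label-rotate t v) (ℤ.+-comm (+ (k ℕ.* n)) (label (rotate t v)))) ⟩
    quiddity (label (rotate t v) + + (k ℕ.* n))
      ≡⟨ periodic-multiple k periodic-n (label (rotate t v)) ⟩
    quiddity (label (rotate t v))
      ≡⟨ quiddity≡trianglesAt (rotate t v) ⟩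
    + trianglesAt T (rotate t v)
      ≡⟨ cong +_ (trianglesAt-rotate preserves v) ⟩
    + trianglesAt T v
      ≡⟨ quiddity≡trianglesAt v ⟨
    quiddity (label v)
      ≡⟨ quiddity-multiple q (label v) ⟨
    quiddity (label v + q * + n)
      ≡⟨ cong quiddity i≡ ⟨
    quiddity i ∎
    where
    open ≡-Reasoning
    -- Labels run from 1 to `n`, so the vertex belonging to `i` is the residue of `i - 1`.
    r<n = ℤ.n%ℕd<d (i - + 1) n
    v = fromℕ< r<n
    q = (i - + 1) ℤ./ℕ n
    k = (toℕ v ℕ.+ t) / n
    identity : ∀ l q t → l + q + t ≡ l + t + q
    identity = solve-∀
    identity′ : ∀ i → i ≡ + 1 + (i - + 1)
    identity′ = solve-∀
    i≡ : i ≡ label v + q * + n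
    i≡ = trans (identity′ i) (trans (cong ℤ.suc (ℤ.a≡a%ℕn+[a/ℕn]*n (i - + 1) n))
      (trans (sym (ℤ.+-assoc (+ 1) (+ ((i - + 1) ℤ.%ℕ n)) (q * + n)))
        (cong (λ r → + suc r + q * + n) (sym (Fin.toℕ-fromℕ< r<n)))))

-- Growth sequences and rotational symmetry

module AssociatedGrowth
  {m : ℕ} (2≤m : 2 ≤ m) {F : Frieze (suc m)} (L : Lattice F)
  {p : ℕ} (minimal : IsMinimalPeriod F p)
  (T : Triangulation (suc m)) (associated : IsAssociatedTo T F) where

  open LatticeTheory 2≤m L using (n)
  open GrowthTheory 2≤m L minimal
  open AssociatedTriangulation 2≤m L T associated using (periodic⇒preserves; preserves⇒periodic)

  preserves-p : Preserves T p
  preserves-p = periodic⇒preserves periodic-p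

  -- The angle `t` of a symmetry is a multiple of `p`, so `d * p` divides `d * t = n = r * p`. With
  -- `r` at most 3 this leaves a single possible `r` for each of `d = 2` and `d = 3`.
  symmetry∣order : ∀ {d t r} → d ℕ.* t ≡ n → Preserves T t → n ≡ r ℕ.* p → d ∣ r
  symmetry∣order {d} {t} {r} dt≡n preserves n≡rp = *-cancelʳ-∣ p (subst₂ _∣_ refl (trans dt≡n n≡rp)
    (*-monoʳ-∣ d (period∣ t (preserves⇒periodic preserves))))

  proper⇒symmetric : ∀ r → n ≡ suc (suc r) ℕ.* p → HasRotationalSymmetry T
  proper⇒symmetric r n≡rp = p , 1≤p ,
    subst (p ℕ.<_) (sym n≡rp) (ℕ.m<m+n p (ℕ.≤-trans 1≤p (ℕ.m≤m+n p (r ℕ.* p)))) , preserves-p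

  asymmetric : n ≡ 1 ℕ.* p → ¬ HasRotationalSymmetry T
  asymmetric n≡p (t@(suc _) , _ , t<n , preserves) = ℕ.<⇒≱ t<n
    (ℕ.≤-trans (ℕ.≤-reflexive (trans n≡p (ℕ.*-identityˡ p)))
      (∣⇒≤ (period∣ t (preserves⇒periodic preserves))))

  -- Index 1 holds the trace, whose values `- 2`, `0` and `1` already tell the three sequences
  -- apart.
  clash : ∀ {s s′} → s 1 ≢ s′ 1 → growth L p ≗ s → ¬ (growth L p ≗ s′)
  clash s≢s′ g g′ = s≢s′ (trans (sym (g 1)) (g′ 1))

  sequence₁⇔asymmetric : growth L p ≗ sequence₁ ⇔ (¬ HasRotationalSymmetry T)
  sequence₁⇔asymmetric = mk⇔ to from
    where
    to : growth L p ≗ sequence₁ → ¬ HasRotationalSymmetry T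
    to g = [ asymmetric ∘ proj₁ ,
           [ (λ (_ , g₂) → contradiction g₂ (clash {sequence₁} {sequence₂} (λ ()) g)) ,
             (λ (_ , g₃) → contradiction g₃ (clash {sequence₁} {sequence₃} (λ ()) g)) ]′ ]′ growth-trichotomy
    from : ¬ HasRotationalSymmetry T → growth L p ≗ sequence₁
    from ¬symmetric = [ proj₂ ,
           [ (λ (n≡2p , _) → contradiction (proper⇒symmetric 0 n≡2p) ¬symmetric) ,
             (λ (n≡3p , _) → contradiction (proper⇒symmetric 1 n≡3p) ¬symmetric) ]′ ]′ growth-trichotomy

  sequence₂⇔180° : growth L p ≗ sequence₂ ⇔ Has180°Symmetry T
  sequence₂⇔180° = mk⇔ to from
    where
    to : growth L p ≗ sequence₂ → Has180°Symmetry T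
    to g = [ (λ (_ , g₁) → contradiction g₁ (clash {sequence₂} {sequence₁} (λ ()) g)) ,
           [ (λ (n≡2p , _) → p , sym n≡2p , preserves-p) ,
             (λ (_ , g₃) → contradiction g₃ (clash {sequence₂} {sequence₃} (λ ()) g)) ]′ ]′ growth-trichotomy
    from : Has180°Symmetry T → growth L p ≗ sequence₂
    from (t , 2t≡n , preserves) =
           [ (λ (n≡p , _) → contradiction (symmetry∣order 2t≡n preserves n≡p) (from-no (2 ∣? 1))) ,
           [ proj₂ ,
             (λ (n≡3p , _) → contradiction (symmetry∣order 2t≡n preserves n≡3p) (from-no (2 ∣? 3))) ]′ ]′
           growth-trichotomy

  sequence₃⇔120° : growth L p ≗ sequence₃ ⇔ Has120°Symmetry T
  sequence₃⇔120° = mk⇔ to from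
    where
    to : growth L p ≗ sequence₃ → Has120°Symmetry T
    to g = [ (λ (_ , g₁) → contradiction g₁ (clash {sequence₃} {sequence₁} (λ ()) g)) ,
           [ (λ (_ , g₂) → contradiction g₂ (clash {sequence₃} {sequence₂} (λ ()) g)) ,
             (λ (n≡3p , _) → p , sym n≡3p , preserves-p) ]′ ]′ growth-trichotomy
    from : Has120°Symmetry T → growth L p ≗ sequence₃
    from (t , 3t≡n , preserves) =
           [ (λ (n≡p , _) → contradiction (symmetry∣order 3t≡n preserves n≡p) (from-no (3 ∣? 1))) ,
           [ (λ (n≡2p , _) → contradiction (symmetry∣order 3t≡n preserves n≡2p) (from-no (3 ∣? 2))) ,
             proj₂ ]′ ]′
           growth-trichotomy

corollary4p2 : (IsLeastPeriodOf sequence₁ 2 × IsLeastPeriodOf sequence₂ 4 × IsLeastPeriodOf sequence₃ 6)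
    ×
    ((n : ℕ) .{{_ : NonZero n}} → 3 ≤ n →
    (F : Frieze n) (L : Lattice F) (p : ℕ) → IsMinimalPeriod F p →
    (growth L p ≗ sequence₁ ⊎ growth L p ≗ sequence₂ ⊎ growth L p ≗ sequence₃)
    ×
    ((T : Triangulation n) → IsAssociatedTo T F →
    (growth L p ≗ sequence₁ ⇔ (¬ HasRotationalSymmetry T))
    × (growth L p ≗ sequence₂ ⇔ Has180°Symmetry T)
    × (growth L p ≗ sequence₃ ⇔ Has120°Symmetry T)))
corollary4p2 = (sequence₁-leastPeriod , sequence₂-leastPeriod , sequence₃-leastPeriod) , growth-classification
  where
  growth-classification :
    (n : ℕ) .{{_ : NonZero n}} → 3 ≤ n →
    (F : Frieze n) (L : Lattice F) (p : ℕ) → IsMinimalPeriod F p →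
    (growth L p ≗ sequence₁ ⊎ growth L p ≗ sequence₂ ⊎ growth L p ≗ sequence₃)
    ×
    ((T : Triangulation n) → IsAssociatedTo T F →
    (growth L p ≗ sequence₁ ⇔ (¬ HasRotationalSymmetry T))
    × (growth L p ≗ sequence₂ ⇔ Has180°Symmetry T)
    × (growth L p ≗ sequence₃ ⇔ Has120°Symmetry T))
  growth-classification (suc m) (s≤s 2≤m) F L p minimal =
    Sum.map proj₂ (Sum.map proj₂ proj₂) (GrowthTheory.growth-trichotomy 2≤m L minimal) ,
    λ T associated → let open AssociatedGrowth 2≤m L minimal T associated in
      sequence₁⇔asymmetric , sequence₂⇔180° , sequence₃⇔120°
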